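{- Let $G$ be a finite group and let $S\subseteq G$ be a subset for which there exists a subset $T\subseteq G$ such that $2\le |T|$ and $|TS|\le \min(|G|-2,\ |T|+|S|-1)$. Suppose moreover that $|S|\le |G|-4|G|^{1/2}$. Then - either $S$ is a geometric progression, i.e. there exist $g,a\in G$ such that one of the two sets $gS$, $Sg$ equals $\{1,a,a^2,\ldots,a^{|S|-1}\}$, - or there exist a non-trivial proper subgroup $H$ of $G$ and $\varepsilon\in\{1,-1\}$ such that $|HS^{\varepsilon}|\le |H|+|S|-1$.
   Context: For subsets $X,Y$ of a group, $XY=\{xy: x\in X, y\in Y\}$. $S^{1}=S$ and $S^{ -1}=\{s^{ -1}: s\in S\}$. -}

module Defs where

open import Algebra.Bundles using (Group)
import Algebra.Definitions.RawMonoid as RawMonoidDefinitions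
open import Data.Fin using (Fin; toℕ)
open import Data.Fin.Properties using (any?) renaming (_≟_ to _≟ᶠ_)
open import Data.Fin.Subset using (Subset; _∈_; ∣_∣; ⁅_⁆; ⊤)
open import Data.Fin.Subset.Properties using (_∈?_)
open import Data.Nat using (ℕ; _≤_; _∸_; _^_) renaming (_*_ to _*ℕ_)
open import Data.Product using (∃; ∃₂; _×_)
open import Data.Sign using (Sign)
open import Data.Sum using (_⊎_)
open import Data.Vec using (tabulate)
open import Function.Bundles using (Inverse)
open import Function.Properties.Inverse using (Inverse⇒Injection)
open import Level using (Level; suc; _⊔_)
open import Relation.Binary.Definitions using (Decidable)
open import Relation.Binary.PropositionalEquality using (_≡_; _≢_; setoid)
open import Relation.Nullary.Decidable using (does; _×-dec_; via-injection)
import Relation.Unary as Unary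

record FiniteGroup (c ℓ : Level) : Set (suc (c ⊔ ℓ)) where
  field
    group       : Group c ℓ
    order       : ℕ
    enumeration : Inverse (Group.setoid group) (setoid (Fin order))

  open Group group public
  open Inverse enumeration public using (to; from)

-- Subsets of a finite group are subsets of Fin order, via the enumeration:
-- x belongs to X when to x ∈ X.  Cardinality is then ∣_∣ from
-- Data.Fin.Subset, and equality of subsets is _≡_.
module Subsets {c ℓ} (G : FiniteGroup c ℓ) where
  open FiniteGroup G
  open RawMonoidDefinitions rawMonoid using () renaming (_×_ to _×ᴹ_)

  infix  4 _∈ᴳ_
  infixl 7 _·_
  infixr 8 _^ˢ_

  _≈?_ : Decidable _≈_
  _≈?_ = via-injection (Inverse⇒Injection enumeration) _≟ᶠ_

  _∈ᴳ_ : Carrier → Subset order → Set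
  x ∈ᴳ X = to x ∈ X

  comprehension : ∀ {p} {P : Unary.Pred Carrier p} → Unary.Decidable P → Subset order
  comprehension P? = tabulate λ i → does (P? (from i))

  singleton : Carrier → Subset order
  singleton g = ⁅ to g ⁆

  _·_ : Subset order → Subset order → Subset order
  X · Y = comprehension
    {P = λ z → ∃₂ λ i j → i ∈ X × j ∈ Y × z ≈ from i ∙ from j}
    λ z → any? λ i → any? λ j →
      (i ∈? X) ×-dec (j ∈? Y) ×-dec (z ≈? (from i ∙ from j))

  inverses : Subset order → Subset order
  inverses X = comprehension
    {P = λ z → ∃ λ i → i ∈ X × z ≈ from i ⁻¹}
    λ z → any? λ i → (i ∈? X) ×-dec (z ≈? (from i ⁻¹))

  _^ˢ_ : Subset order → Sign → Subset order
  X ^ˢ Sign.+ = X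
  X ^ˢ Sign.- = inverses X

  -- {1, a, …, aᵏ⁻¹}; the library's n ×ᴹ a is aⁿ in multiplicative notation.
  powers : Carrier → ℕ → Subset order
  powers a k = comprehension
    {P = λ z → ∃ λ (i : Fin k) → z ≈ toℕ i ×ᴹ a}
    λ z → any? λ i → z ≈? (toℕ i ×ᴹ a)

  IsGeometricProgression : Subset order → Set c
  IsGeometricProgression S = ∃₂ λ g a →
    (singleton g · S ≡ powers a ∣ S ∣) ⊎ (S · singleton g ≡ powers a ∣ S ∣)

  record IsSubgroup (H : Subset order) : Set c where
    field
      ε-∈       : ε ∈ᴳ H
      ∙-closed  : ∀ {x y} → x ∈ᴳ H → y ∈ᴳ H → x ∙ y ∈ᴳ H
      ⁻¹-closed : ∀ {x} → x ∈ᴳ H → x ⁻¹ ∈ᴳ H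

  Nontrivial Proper : Subset order → Set
  Nontrivial H = H ≢ singleton ε
  Proper     H = H ≢ ⊤

-- m ≤ n - 4 √n over the reals, i.e. 4 √n ≤ n - m.  The left side is
-- nonnegative, so this says that n - m ≥ 0 and 16 n ≤ (n - m)².
infix 4 _≤[_-4√n]

_≤[_-4√n] : ℕ → ℕ → Set
m ≤[ n -4√n] = m ≤ n × 16 *ℕ n ≤ (n ∸ m) ^ 2

{-# OPTIONS --safe #-}
module Submission where

-- The proof uses the isoperimetric method.  The excess of X is |XS| - |X|.
-- It is submodular, and passing from X to the complement of XS exchanges S
-- with its set of inverses without increasing the excess.  A k-atom has
-- least excess, and then least size, among all X with |X| ≥ k and
-- |G − XS| ≥ k, for S and for its set of inverses together.  Two k-atoms
-- sharing k elements coincide (atoms-meet⇒⊆).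
--
-- Hence the 1-atom containing the identity is a subgroup K.  Comparison with
-- a singleton gives |KS| ≤ |K| + |S| - 1 for S or its set of inverses, so it
-- may be assumed that K is trivial.  Then |XS| ≥ |X| + |S| - 1 whenever X is
-- nonempty and XS ≠ G, and sets X with |XS| ≤ |X| + |S| - 1, called small,
-- have a small union if they meet.  The set T makes the 2-atom A small; let it
-- be an atom for S containing the identity.  The subgroup generated by A is
-- a union of translates of A, hence small (generated-small), so it may be
-- assumed that A generates G.  If |A| = 2, then S is a progression
-- (two-element⇒Progression).
--
-- The case m = |A| ≥ 3 is contradictory.  Let M be a largest small set with
-- |G − MS| ≥ 2.  A left translate gA that meets M without being contained in
-- it meets M in one element; moreover |G − MS| = m, and M ∪ gA is the
-- complement of zS⁻¹ for some z outside MS that determines gA.  Counting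
-- these z shows that U, the set of g with gA inside M, satisfies
-- r(|M| - |U|) ≤ m for r ≤ 3 right cosets in A of the left stabiliser H of A.
-- Since UA is contained in M, while |UA| - |U| ≥ m / 2 for a generating set
-- (Generates⇒excess, again by 1-atoms), A is the union of exactly two cosets
-- H and Ha, and |UA| ≤ |U| + |H|.
--
-- The double coset HaH has |H|² elements, so |S| ≤ |G| - 4|G|^½ forces U to
-- contain more than one left coset of H.  Take a smallest union W of more
-- than one left coset, with complement of the same kind, such that
-- |WA| ≤ |W| + |H|.  Uncrossing W with its left translates and with their
-- complements shows that W is a subgroup, which contradicts that A
-- generates G, or that |W| ≤ 2|H|, which contradicts that two translates of
-- A share at most one element (no-cut).

open import Defs
open import Algebra.Bundles using (Group)
open import Algebra.Bundles.Raw using (RawGroup)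
open import Algebra.Core using (Op₁; Op₂)
import Algebra.Definitions.RawMonoid as RawMonoidDefinitions
import Algebra.Morphism.GroupMonomorphism as GroupMonomorphism
open import Algebra.Morphism.Structures using (IsGroupMonomorphism)
import Algebra.Properties.Group as GroupProperties
open import Algebra.Structures using (IsGroup)
open import Data.Fin using (Fin; zero; suc; toℕ; fromℕ<; combine; remQuot)
open import Data.Fin.Properties using (any?; injective⇒≤; combine-remQuot; toℕ<n; toℕ-fromℕ<; toℕ-injective)
  renaming (_≟_ to _≟ᶠ_; suc-injective to sucᶠ-injective)
open import Data.Fin.Subset using (Subset; ∣_∣; _∈_; _∉_; _⊆_; _∩_; _∪_; ∁; ⁅_⁆; ⊤; Nonempty; inside; outside)
open import Data.Fin.Subset.Properties
open import Data.List using ([]; _∷_)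
open import Data.Nat using (ℕ; zero; suc; z≤n; s≤s; _≤_; _<_; _+_; _*_; _∸_; _⊓_; _^_)
open import Data.Nat.Induction using (<-wellFounded)
open import Data.Nat.Properties hiding (_≟_)
open import Data.Nat.Tactic.RingSolver using (solve)
open import Data.Product using (∃; ∃₂; _×_; _,_; proj₁; proj₂)
open import Data.Sign using (Sign)
open import Data.Sum using (_⊎_; inj₁; inj₂)
open import Data.Vec using (tabulate; here; there) renaming ([] to []ᵛ; _∷_ to _∷ᵛ_)
open import Data.Vec.Properties using (lookup⇒[]=; []=⇒lookup; lookup∘tabulate)
open import Function using (_∘_; id; case_of_)
open import Function.Bundles using (Inverse)
open import Induction.WellFounded using (Acc; acc)
open import Relation.Binary.Definitions using (tri<; tri≈; tri>)
open import Relation.Binary.PropositionalEquality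
  using (_≡_; _≢_; refl; sym; trans; cong; cong₂; subst; subst₂; module ≡-Reasoning)
open import Relation.Nullary using (Dec; yes; no; ¬_; contradiction; does)
open import Relation.Nullary.Decidable using (dec-true; decidable-stable; ¬?; _×-dec_)
open import Relation.Unary using (Decidable)

private
  variable
    l n : ℕ

-- Linear arithmetic

-- A linear inequality a ≤ b follows from a summed system L ≤ R of known
-- inequalities once a + R + c = b + L is an identity.
lin : ∀ {L R a b} c → L ≤ R → a + R + c ≡ b + L → a ≤ b
lin {L} {R} {a} {b} c L≤R eq = +-cancelʳ-≤ R a b (begin
  a + R      ≤⟨ m≤m+n (a + R) c ⟩
  a + R + c  ≡⟨ eq ⟩
  b + L      ≤⟨ +-monoʳ-≤ b L≤R ⟩
  b + R      ∎)
  where open ≤-Reasoning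

infixr 5 _⊕_
_⊕_ : ∀ {a b c d} → a ≤ b → c ≤ d → a + c ≤ b + d
_⊕_ = +-mono-≤

-- Subsets of a finite set

∈tabulate⁺ : ∀ {p} {P : Fin n → Set p} (P? : Decidable P) {x : Fin n} → P x → x ∈ tabulate (does ∘ P?)
∈tabulate⁺ P? {x} px = lookup⇒[]= x _ (trans (lookup∘tabulate _ x) (dec-true (P? x) px))

∈tabulate⁻ : ∀ {p} {P : Fin n → Set p} (P? : Decidable P) {x : Fin n} → x ∈ tabulate (does ∘ P?) → P x
∈tabulate⁻ P? {x} x∈ with P? x | trans (sym (lookup∘tabulate (does ∘ P?) x)) ([]=⇒lookup x∈)
... | yes px | _ = px

opaque
  -- The subset of elements satisfying a decidable predicate.
  ⟪_⟫ : {P : Fin n → Set} → Decidable P → Subset n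
  ⟪ P? ⟫ = tabulate (does ∘ P?)

  ∈⟪⟫⁺ : {P : Fin n → Set} (P? : Decidable P) {x : Fin n} → P x → x ∈ ⟪ P? ⟫
  ∈⟪⟫⁺ = ∈tabulate⁺

  ∈⟪⟫⁻ : {P : Fin n → Set} (P? : Decidable P) {x : Fin n} → x ∈ ⟪ P? ⟫ → P x
  ∈⟪⟫⁻ = ∈tabulate⁻

-- The increasing enumeration of the elements of X, and the position of an
-- element of X in it.
enum : (X : Subset n) → Fin ∣ X ∣ → Fin n
enum (inside  ∷ᵛ X) zero    = zero
enum (inside  ∷ᵛ X) (suc i) = suc (enum X i)
enum (outside ∷ᵛ X) i       = suc (enum X i)

enum∈ : (X : Subset n) (i : Fin ∣ X ∣) → enum X i ∈ X
enum∈ (inside  ∷ᵛ X) zero    = here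
enum∈ (inside  ∷ᵛ X) (suc i) = there (enum∈ X i)
enum∈ (outside ∷ᵛ X) i       = there (enum∈ X i)

enum-injective : (X : Subset n) {i j : Fin ∣ X ∣} → enum X i ≡ enum X j → i ≡ j
enum-injective (inside  ∷ᵛ X) {zero}  {zero}  eq = refl
enum-injective (inside  ∷ᵛ X) {suc i} {suc j} eq = cong suc (enum-injective X (sucᶠ-injective eq))
enum-injective (outside ∷ᵛ X) eq = enum-injective X (sucᶠ-injective eq)

rank : (X : Subset n) {x : Fin n} → x ∈ X → Fin ∣ X ∣
rank (inside  ∷ᵛ X) here       = zero
rank (inside  ∷ᵛ X) (there x∈) = suc (rank X x∈)
rank (outside ∷ᵛ X) (there x∈) = rank X x∈

rank-injective : (X : Subset n) {x y : Fin n} (x∈ : x ∈ X) (y∈ : y ∈ X) → rank X x∈ ≡ rank X y∈ → x ≡ y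
rank-injective (inside  ∷ᵛ X) here       here       eq = refl
rank-injective (inside  ∷ᵛ X) (there x∈) (there y∈) eq = cong suc (rank-injective X x∈ y∈ (sucᶠ-injective eq))
rank-injective (outside ∷ᵛ X) (there x∈) (there y∈) eq = cong suc (rank-injective X x∈ y∈ eq)

-- An injective total relation from X to Y bounds the size of X.
injection⇒∣∣≤ : (X : Subset l) (Y : Subset n) (R : Fin l → Fin n → Set) →
  (∀ {x} → x ∈ X → ∃ λ y → y ∈ Y × R x y) →
  (∀ {x x' y} → x ∈ X → x' ∈ X → R x y → R x' y → x ≡ x') →
  ∣ X ∣ ≤ ∣ Y ∣
injection⇒∣∣≤ X Y R total inj = injective⇒≤ {f = λ i → rank Y (proj₁ (proj₂ (image i)))} λ {i} {j} eq →
  enum-injective X (inj (enum∈ X i) (enum∈ X j) (proj₂ (proj₂ (image i)))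
    (subst (R _) (sym (rank-injective Y _ _ eq)) (proj₂ (proj₂ (image j)))))
  where
  image : (i : Fin ∣ X ∣) → ∃ λ y → y ∈ Y × R (enum X i) y
  image i = total (enum∈ X i)

function⇒∣∣≤ : (X : Subset l) (Y : Subset n) (f : Fin l → Fin n) →
  (∀ {x} → x ∈ X → f x ∈ Y) → (∀ {x x'} → x ∈ X → x' ∈ X → f x ≡ f x' → x ≡ x') → ∣ X ∣ ≤ ∣ Y ∣
function⇒∣∣≤ X Y f f∈ inj = injection⇒∣∣≤ X Y (λ x y → y ≡ f x) (λ x∈ → _ , f∈ x∈ , refl)
  λ x∈ x'∈ y≡ y≡' → inj x∈ x'∈ (trans (sym y≡) y≡')

∣p∪q∣+∣p∩q∣ : (p q : Subset n) → ∣ p ∪ q ∣ + ∣ p ∩ q ∣ ≡ ∣ p ∣ + ∣ q ∣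
∣p∪q∣+∣p∩q∣ []ᵛ            []ᵛ            = refl
∣p∪q∣+∣p∩q∣ (outside ∷ᵛ p) (outside ∷ᵛ q) = ∣p∪q∣+∣p∩q∣ p q
∣p∪q∣+∣p∩q∣ (inside  ∷ᵛ p) (outside ∷ᵛ q) = cong suc (∣p∪q∣+∣p∩q∣ p q)
∣p∪q∣+∣p∩q∣ (outside ∷ᵛ p) (inside  ∷ᵛ q) = trans (cong suc (∣p∪q∣+∣p∩q∣ p q)) (sym (+-suc ∣ p ∣ ∣ q ∣))
∣p∪q∣+∣p∩q∣ (inside  ∷ᵛ p) (inside  ∷ᵛ q) = cong suc (trans (+-suc ∣ p ∪ q ∣ ∣ p ∩ q ∣)
  (trans (cong suc (∣p∪q∣+∣p∩q∣ p q)) (sym (+-suc ∣ p ∣ ∣ q ∣))))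

∣∪∣≤ : (p q : Subset n) → ∣ p ∪ q ∣ ≤ ∣ p ∣ + ∣ q ∣
∣∪∣≤ p q = subst (∣ p ∪ q ∣ ≤_) (∣p∪q∣+∣p∩q∣ p q) (m≤m+n _ _)

∣p∣+∣∁p∣ : (p : Subset n) → ∣ p ∣ + ∣ ∁ p ∣ ≡ n
∣p∣+∣∁p∣ p = trans (cong (∣ p ∣ +_) (∣∁p∣≡n∸∣p∣ p)) (m+[n∸m]≡n (∣p∣≤n p))

⊆∧∣∣≥⇒⊇ : {p q : Subset n} → p ⊆ q → ∣ q ∣ ≤ ∣ p ∣ → q ⊆ p
⊆∧∣∣≥⇒⊇ {p = p} p⊆q q≤p {x} x∈q with x ∈? p
... | yes x∈p = x∈p
... | no  x∉p = contradiction q≤p (<⇒≱ (p⊂q⇒∣p∣<∣q∣ (p⊆q , x , x∈q , x∉p)))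

∈⇒1≤∣∣ : {p : Subset n} {x : Fin n} → x ∈ p → 1 ≤ ∣ p ∣
∈⇒1≤∣∣ {x = x} x∈p = subst (_≤ _) (∣⁅x⁆∣≡1 x) (p⊆q⇒∣p∣≤∣q∣ λ y∈ → subst (_∈ _) (sym (x∈⁅y⁆⇒x≡y x y∈)) x∈p)

1≤∣∣⇒Nonempty : (p : Subset n) → 1 ≤ ∣ p ∣ → Nonempty p
1≤∣∣⇒Nonempty p 1≤ with ∣ p ∣ | enum p | enum∈ p
... | suc _ | f | f∈ = f zero , f∈ zero

-- A subset larger than q has an element outside q.
∣∣<⇒∃∉ : (p q : Subset n) → ∣ q ∣ < ∣ p ∣ → ∃ λ x → x ∈ p × x ∉ q
∣∣<⇒∃∉ p q q<p with any? (λ x → (x ∈? p) ×-dec ¬? (x ∈? q))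
... | yes found = found
... | no  none  = contradiction q<p (≤⇒≯ (p⊆q⇒∣p∣≤∣q∣ λ {x} x∈p →
  decidable-stable (x ∈? q) λ x∉q → none (x , x∈p , x∉q)))

∣∣≤1⇒≡ : {p : Subset n} {x y : Fin n} → ∣ p ∣ ≤ 1 → x ∈ p → y ∈ p → x ≡ y
∣∣≤1⇒≡ {p = p} {x} {y} p≤1 x∈ y∈ = sym (x∈⁅y⁆⇒x≡y x (⊆∧∣∣≥⇒⊇ {p = ⁅ x ⁆} {q = p}
  (λ z∈ → subst (_∈ p) (sym (x∈⁅y⁆⇒x≡y x z∈)) x∈) (subst (∣ p ∣ ≤_) (sym (∣⁅x⁆∣≡1 x)) p≤1) y∈))

≢⇒2≤∣∣ : {p : Subset n} {x y : Fin n} → x ∈ p → y ∈ p → x ≢ y → 2 ≤ ∣ p ∣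
≢⇒2≤∣∣ x∈ y∈ x≢y = ≰⇒> λ p≤1 → x≢y (∣∣≤1⇒≡ p≤1 x∈ y∈)

disjoint⇒∣∪∣ : {p q : Subset n} → (∀ {x} → x ∈ p → x ∉ q) → ∣ p ∣ + ∣ q ∣ ≤ ∣ p ∪ q ∣
disjoint⇒∣∪∣ {p = p} {q} disj with ∣ p ∩ q ∣ in eq | ∣p∪q∣+∣p∩q∣ p q
... | zero  | e = ≤-reflexive (trans (sym e) (+-identityʳ _))
... | suc _ | _ with 1≤∣∣⇒Nonempty (p ∩ q) (subst (1 ≤_) (sym eq) (s≤s z≤n))
...   | x , x∈ with x∈p∩q⁻ p q x∈
...     | x∈p , x∈q = contradiction x∈q (disj x∈p)

-- Minimisation

-- A type is searchable if it is decidable whether a given decidable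
-- predicate is satisfied somewhere on it.
Searchable : Set → Set₁
Searchable A = {P : A → Set} → Decidable P → Dec (∃ P)

opaque
  argmin : {A : Set} → Searchable A → {P : A → Set} → Decidable P → (μ : A → ℕ) → ∃ P →
    ∃ λ x → P x × (∀ y → P y → μ x ≤ μ y)
  argmin {A} search {P} P? μ (x₀ , px₀) = go x₀ px₀ (<-wellFounded (μ x₀))
    where
    go : ∀ x → P x → Acc _<_ (μ x) → ∃ λ z → P z × (∀ y → P y → μ z ≤ μ y)
    go x px (acc rec) with search (λ y → P? y ×-dec (μ y <? μ x))
    ... | yes (y , py , y<x) = go y py (rec y<x)
    ... | no  none           = x , px , λ y py → ≮⇒≥ λ y<x → none (y , py , y<x)

subsets-searchable : Searchable (Subset n)
subsets-searchable P? = anySubset? P?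

signed-subsets-searchable : Searchable (Sign × Subset n)
signed-subsets-searchable P? with anySubset? (λ X → P? (Sign.+ , X)) | anySubset? (λ X → P? (Sign.- , X))
... | yes (X , p) | _           = yes ((Sign.+ , X) , p)
... | no _        | yes (X , p) = yes ((Sign.- , X) , p)
... | no ¬+       | no ¬-       = no λ { ((Sign.+ , X) , p) → ¬+ (X , p) ; ((Sign.- , X) , p) → ¬- (X , p) }

-- Product sets in a finite group

-- The theory of a group structure on Fin n, whose subsets are Subset n.
module FiniteGroupTheory {n : ℕ} {mul : Op₂ (Fin n)} {unit : Fin n} {inverse : Op₁ (Fin n)}
  (isGroup : IsGroup _≡_ mul unit inverse) where

  private
    group : Group _ _
    group = record { isGroup = isGroup }

  open Group group using (_∙_; ε; _⁻¹; assoc; identityˡ; identityʳ; inverseˡ; inverseʳ)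
  open GroupProperties group using (⁻¹-involutive; ⁻¹-anti-homo-∙; ∙-cancelˡ; ∙-cancelʳ; ε⁻¹≈ε)

  x⁻¹∙xy≡y : ∀ x y → x ⁻¹ ∙ (x ∙ y) ≡ y
  x⁻¹∙xy≡y x y = trans (sym (assoc (x ⁻¹) x y)) (trans (cong (_∙ y) (inverseˡ x)) (identityˡ y))

  x∙x⁻¹y≡y : ∀ x y → x ∙ (x ⁻¹ ∙ y) ≡ y
  x∙x⁻¹y≡y x y = trans (sym (assoc x (x ⁻¹) y)) (trans (cong (_∙ y) (inverseʳ x)) (identityˡ y))

  xy∙y⁻¹≡x : ∀ x y → (x ∙ y) ∙ y ⁻¹ ≡ x
  xy∙y⁻¹≡x x y = trans (assoc x y (y ⁻¹)) (trans (cong (x ∙_) (inverseʳ y)) (identityʳ x))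

  xy⁻¹∙y≡x : ∀ x y → (x ∙ y ⁻¹) ∙ y ≡ x
  xy⁻¹∙y≡x x y = trans (assoc x (y ⁻¹) y) (trans (cong (x ∙_) (inverseˡ y)) (identityʳ x))

  infixl 7.5 _⊙_ _▸_
  infixr 7.6 _◂_

  opaque
    -- The product set XY.
    _⊙_ : Subset n → Subset n → Subset n
    X ⊙ Y = ⟪ (λ z → any? λ x → (x ∈? X) ×-dec (x ⁻¹ ∙ z ∈? Y)) ⟫

    -- The left translate gX, the right translate Xg, and the set of inverses.
    _◂_ : Fin n → Subset n → Subset n
    g ◂ X = ⟪ (λ z → g ⁻¹ ∙ z ∈? X) ⟫

    _▸_ : Subset n → Fin n → Subset n
    X ▸ g = ⟪ (λ z → z ∙ g ⁻¹ ∈? X) ⟫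

    inv : Subset n → Subset n
    inv X = ⟪ (λ z → z ⁻¹ ∈? X) ⟫

    ∈⊙⁺ : ∀ {X Y x y} → x ∈ X → y ∈ Y → x ∙ y ∈ X ⊙ Y
    ∈⊙⁺ {X} {Y} {x} {y} x∈ y∈ = ∈⟪⟫⁺ _ (x , x∈ , subst (_∈ Y) (sym (x⁻¹∙xy≡y x y)) y∈)

    ∈⊙⁻ : ∀ {X Y z} → z ∈ X ⊙ Y → ∃₂ λ x y → x ∈ X × y ∈ Y × z ≡ x ∙ y
    ∈⊙⁻ {z = z} z∈ with ∈⟪⟫⁻ _ z∈
    ... | x , x∈ , y∈ = x , x ⁻¹ ∙ z , x∈ , y∈ , sym (x∙x⁻¹y≡y x z)

    ∈◂⁺ : ∀ {g X x} → x ∈ X → g ∙ x ∈ g ◂ X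
    ∈◂⁺ {g} {X} {x} x∈ = ∈⟪⟫⁺ _ (subst (_∈ X) (sym (x⁻¹∙xy≡y g x)) x∈)

    ∈◂⁺′ : ∀ {g X z} → g ⁻¹ ∙ z ∈ X → z ∈ g ◂ X
    ∈◂⁺′ = ∈⟪⟫⁺ _

    ∈◂⁻ : ∀ {g X z} → z ∈ g ◂ X → g ⁻¹ ∙ z ∈ X
    ∈◂⁻ = ∈⟪⟫⁻ _

    ∈▸⁺ : ∀ {g X x} → x ∈ X → x ∙ g ∈ X ▸ g
    ∈▸⁺ {g} {X} {x} x∈ = ∈⟪⟫⁺ _ (subst (_∈ X) (sym (xy∙y⁻¹≡x x g)) x∈)

    ∈▸⁻ : ∀ {g X z} → z ∈ X ▸ g → z ∙ g ⁻¹ ∈ X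
    ∈▸⁻ = ∈⟪⟫⁻ _

    ∈inv⁺ : ∀ {X x} → x ∈ X → x ⁻¹ ∈ inv X
    ∈inv⁺ {X} {x} x∈ = ∈⟪⟫⁺ _ (subst (_∈ X) (sym (⁻¹-involutive x)) x∈)

    ∈inv⁻ : ∀ {X z} → z ∈ inv X → z ⁻¹ ∈ X
    ∈inv⁻ = ∈⟪⟫⁻ _

  inv-involutive : ∀ X → inv (inv X) ≡ X
  inv-involutive X = ⊆-antisym
    (λ {x} x∈ → subst (_∈ X) (⁻¹-involutive x) (∈inv⁻ (∈inv⁻ x∈)))
    (λ {x} x∈ → subst (_∈ inv (inv X)) (⁻¹-involutive x) (∈inv⁺ (∈inv⁺ x∈)))

  ⁻¹-injective : ∀ {x y} → x ⁻¹ ≡ y ⁻¹ → x ≡ y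
  ⁻¹-injective {x} {y} eq = trans (sym (⁻¹-involutive x)) (trans (cong _⁻¹ eq) (⁻¹-involutive y))

  ∣inv∣ : ∀ X → ∣ inv X ∣ ≡ ∣ X ∣
  ∣inv∣ X = ≤-antisym (function⇒∣∣≤ (inv X) X _⁻¹ ∈inv⁻ λ _ _ → ⁻¹-injective)
                      (function⇒∣∣≤ X (inv X) _⁻¹ ∈inv⁺ λ _ _ → ⁻¹-injective)

  ∣◂∣ : ∀ g X → ∣ g ◂ X ∣ ≡ ∣ X ∣
  ∣◂∣ g X = ≤-antisym (function⇒∣∣≤ (g ◂ X) X (g ⁻¹ ∙_) ∈◂⁻ λ _ _ → ∙-cancelˡ (g ⁻¹) _ _)
                      (function⇒∣∣≤ X (g ◂ X) (g ∙_) ∈◂⁺ λ _ _ → ∙-cancelˡ g _ _)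

  ∣▸∣ : ∀ X g → ∣ X ▸ g ∣ ≡ ∣ X ∣
  ∣▸∣ X g = ≤-antisym (function⇒∣∣≤ (X ▸ g) X (_∙ g ⁻¹) ∈▸⁻ λ _ _ → ∙-cancelʳ (g ⁻¹) _ _)
                      (function⇒∣∣≤ X (X ▸ g) (_∙ g) ∈▸⁺ λ _ _ → ∙-cancelʳ g _ _)

  ⊙-monoˡ : ∀ {X Y S} → X ⊆ Y → X ⊙ S ⊆ Y ⊙ S
  ⊙-monoˡ {Y = Y} {S} X⊆Y z∈ with ∈⊙⁻ z∈
  ... | x , s , x∈ , s∈ , refl = ∈⊙⁺ (X⊆Y x∈) s∈

  X⊆X⊙A : ∀ {X A} → ε ∈ A → X ⊆ X ⊙ A
  X⊆X⊙A {X} {A} ε∈ {x} x∈ = subst (_∈ X ⊙ A) (identityʳ x) (∈⊙⁺ x∈ ε∈)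

  ∪-⊙ : ∀ {X Y S} → (X ∪ Y) ⊙ S ⊆ X ⊙ S ∪ Y ⊙ S
  ∪-⊙ {X} {Y} z∈ with ∈⊙⁻ z∈
  ... | x , s , x∈ , s∈ , refl with x∈p∪q⁻ X Y x∈
  ...   | inj₁ x∈X = x∈p∪q⁺ (inj₁ (∈⊙⁺ x∈X s∈))
  ...   | inj₂ x∈Y = x∈p∪q⁺ (inj₂ (∈⊙⁺ x∈Y s∈))

  submodular : ∀ X Y S → ∣ (X ∪ Y) ⊙ S ∣ + ∣ (X ∩ Y) ⊙ S ∣ ≤ ∣ X ⊙ S ∣ + ∣ Y ⊙ S ∣
  submodular X Y S = ≤-trans
    (p⊆q⇒∣p∣≤∣q∣ ∪-⊙ ⊕ p⊆q⇒∣p∣≤∣q∣ λ z∈ →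
      x∈p∩q⁺ (⊙-monoˡ (p∩q⊆p X Y) z∈ , ⊙-monoˡ (p∩q⊆q X Y) z∈))
    (≤-reflexive (∣p∪q∣+∣p∩q∣ (X ⊙ S) (Y ⊙ S)))

  ◂-⊙⊆ : ∀ {g X S} → (g ◂ X) ⊙ S ⊆ g ◂ (X ⊙ S)
  ◂-⊙⊆ {g} {X} {S} z∈ with ∈⊙⁻ z∈
  ... | x , s , x∈ , s∈ , refl = ∈◂⁺′ (subst (_∈ X ⊙ S) (assoc (g ⁻¹) x s) (∈⊙⁺ (∈◂⁻ x∈) s∈))

  ◂-⊙⊇ : ∀ {g X S} → g ◂ (X ⊙ S) ⊆ (g ◂ X) ⊙ S
  ◂-⊙⊇ {g} {X} {S} {z} z∈ with ∈⊙⁻ (∈◂⁻ z∈)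
  ... | x , s , x∈ , s∈ , eq = subst (_∈ (g ◂ X) ⊙ S)
    (trans (assoc g x s) (trans (cong (g ∙_) (sym eq)) (x∙x⁻¹y≡y g z))) (∈⊙⁺ (∈◂⁺ x∈) s∈)

  ∣◂⊙∣ : ∀ g X S → ∣ (g ◂ X) ⊙ S ∣ ≡ ∣ X ⊙ S ∣
  ∣◂⊙∣ g X S = trans (cong ∣_∣ (⊆-antisym ◂-⊙⊆ ◂-⊙⊇)) (∣◂∣ g (X ⊙ S))

  infixl 7.5 _⋆_

  -- The elements outside XS; passing from X to this set exchanges S with
  -- its set of inverses.
  _⋆_ : Subset n → Subset n → Subset n
  X ⋆ S = ∁ (X ⊙ S)

  ∣⊙∣+∣⋆∣ : ∀ X S → ∣ X ⊙ S ∣ + ∣ X ⋆ S ∣ ≡ n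
  ∣⊙∣+∣⋆∣ X S = ∣p∣+∣∁p∣ (X ⊙ S)

  ⋆⊙inv⊆∁ : ∀ {X S} → (X ⋆ S) ⊙ inv S ⊆ ∁ X
  ⋆⊙inv⊆∁ {X} {S} z∈ with ∈⊙⁻ z∈
  ... | y , t , y∈ , t∈ , refl = x∉p⇒x∈∁p λ yt∈X →
    x∈∁p⇒x∉p y∈ (subst (_∈ X ⊙ S) (xy∙y⁻¹≡x y t) (∈⊙⁺ yt∈X (∈inv⁻ t∈)))

  ⋆-antitone : ∀ {X Y S} → X ⊆ Y → Y ⋆ S ⊆ X ⋆ S
  ⋆-antitone X⊆Y = p⊆q⇒∁p⊇∁q (⊙-monoˡ X⊆Y)

  ∣◂⋆∣ : ∀ g X S → ∣ (g ◂ X) ⋆ S ∣ ≡ ∣ X ⋆ S ∣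
  ∣◂⋆∣ g X S = +-cancelˡ-≡ ∣ X ⊙ S ∣ _ _ (trans (cong (_+ ∣ (g ◂ X) ⋆ S ∣) (sym (∣◂⊙∣ g X S)))
    (trans (∣⊙∣+∣⋆∣ (g ◂ X) S) (sym (∣⊙∣+∣⋆∣ X S))))

  -- Atoms

  -- X is admissible if it and the complement of XS have at least k elements.
  Adm : ℕ → Subset n → Subset n → Set
  Adm k S X = k ≤ ∣ X ∣ × k ≤ ∣ X ⋆ S ∣

  -- Among the sets that are admissible for S or for its set of inverses,
  -- F minimises first the excess, which is the size of the product minus
  -- that of the set, and then the size.
  record IsAtom (k : ℕ) (S F : Subset n) : Set where
    field
      adm    : Adm k S F
      least  : ∀ {Y} → Adm k S Y → ∣ F ⊙ S ∣ + ∣ Y ∣ ≤ ∣ Y ⊙ S ∣ + ∣ F ∣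
      least⁻ : ∀ {Y} → Adm k (inv S) Y → ∣ F ⊙ S ∣ + ∣ Y ∣ ≤ ∣ Y ⊙ inv S ∣ + ∣ F ∣
      small  : ∀ {Y} → Adm k S Y → ∣ Y ⊙ S ∣ + ∣ F ∣ ≤ ∣ F ⊙ S ∣ + ∣ Y ∣ → ∣ F ∣ ≤ ∣ Y ∣
      small⁻ : ∀ {Y} → Adm k (inv S) Y → ∣ Y ⊙ inv S ∣ + ∣ F ∣ ≤ ∣ F ⊙ S ∣ + ∣ Y ∣ → ∣ F ∣ ≤ ∣ Y ∣

  -- The sum |XS| + |∁ X| exceeds the excess of X by n, so it can be used to
  -- compare excesses by a natural number.
  exchange : ∀ {a b f y} (F Y : Subset n) → ∣ F ∣ ≡ f → ∣ Y ∣ ≡ y →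
    a + ∣ ∁ F ∣ ≤ b + ∣ ∁ Y ∣ → a + y ≤ b + f
  exchange {a} {b} {f} {y} F Y refl refl h = arith a b f y (∣ ∁ F ∣) (∣ ∁ Y ∣) n h
    (≤-reflexive (∣p∣+∣∁p∣ Y)) (≤-reflexive (sym (∣p∣+∣∁p∣ F)))
    where
    arith : ∀ a b f y f′ y′ n → a + f′ ≤ b + y′ → y + y′ ≤ n → n ≤ f + f′ → a + y ≤ b + f
    arith a b f y f′ y′ n h₁ h₂ h₃ = lin 0 (h₁ ⊕ h₂ ⊕ h₃) (solve (a ∷ b ∷ f ∷ y ∷ f′ ∷ y′ ∷ n ∷ []))

  exchange⁻ : ∀ {a b} (F Y : Subset n) → a + ∣ F ∣ ≤ b + ∣ Y ∣ → a + ∣ ∁ Y ∣ ≤ b + ∣ ∁ F ∣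
  exchange⁻ {a} {b} F Y h = arith a b (∣ F ∣) (∣ Y ∣) (∣ ∁ F ∣) (∣ ∁ Y ∣) n h
    (≤-reflexive (∣p∣+∣∁p∣ Y)) (≤-reflexive (sym (∣p∣+∣∁p∣ F)))
    where
    arith : ∀ a b f y f′ y′ n → a + f ≤ b + y → y + y′ ≤ n → n ≤ f + f′ → a + y′ ≤ b + f′
    arith a b f y f′ y′ n h₁ h₂ h₃ = lin 0 (h₁ ⊕ h₂ ⊕ h₃) (solve (a ∷ b ∷ f ∷ y ∷ f′ ∷ y′ ∷ n ∷ []))

  atom-exists : ∀ {k S X} → Adm k S X → ∃ λ F → IsAtom k S F ⊎ IsAtom k (inv S) F
  atom-exists {k} {S} {X} admX = conclude best
    where
    signed : Sign → Subset n
    signed Sign.+ = S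
    signed Sign.- = inv S

    μ : Sign × Subset n → ℕ
    μ (δ , Y) = ∣ Y ⊙ signed δ ∣ + ∣ ∁ Y ∣

    P : Sign × Subset n → Set
    P (δ , Y) = Adm k (signed δ) Y

    P? : Decidable P
    P? (δ , Y) = (k ≤? ∣ Y ∣) ×-dec (k ≤? ∣ Y ⋆ signed δ ∣)

    lowest : ∃ λ p → P p × (∀ q → P q → μ p ≤ μ q)
    lowest = argmin signed-subsets-searchable P? μ ((Sign.+ , X) , admX)

    μ₀ = μ (proj₁ lowest)

    best : ∃ λ p → (P p × μ p ≤ μ₀) × (∀ q → P q × μ q ≤ μ₀ → ∣ proj₂ p ∣ ≤ ∣ proj₂ q ∣)
    best = argmin signed-subsets-searchable (λ q → P? q ×-dec (μ q ≤? μ₀)) (∣_∣ ∘ proj₂)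
      (proj₁ lowest , proj₁ (proj₂ lowest) , ≤-refl)

    module _ (δ : Sign) (F : Subset n) (admF : P (δ , F)) (F≤ : μ (δ , F) ≤ μ₀)
      (least-size : ∀ q → P q × μ q ≤ μ₀ → ∣ F ∣ ≤ ∣ proj₂ q ∣) where

      least : ∀ γ {Y} → P (γ , Y) → ∣ F ⊙ signed δ ∣ + ∣ Y ∣ ≤ ∣ Y ⊙ signed γ ∣ + ∣ F ∣
      least γ {Y} admY = exchange F Y refl refl (≤-trans F≤ (proj₂ (proj₂ lowest) (γ , Y) admY))

      small : ∀ γ {Y} → P (γ , Y) → ∣ Y ⊙ signed γ ∣ + ∣ F ∣ ≤ ∣ F ⊙ signed δ ∣ + ∣ Y ∣ → ∣ F ∣ ≤ ∣ Y ∣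
      small γ {Y} admY h = least-size (γ , Y) (admY , ≤-trans (exchange⁻ F Y h) F≤)

    conclude : (∃ λ p → (P p × μ p ≤ μ₀) × (∀ q → P q × μ q ≤ μ₀ → ∣ proj₂ p ∣ ≤ ∣ proj₂ q ∣)) →
      ∃ λ F → IsAtom k S F ⊎ IsAtom k (inv S) F
    conclude ((Sign.+ , F) , (admF , F≤) , min) = F , inj₁ record
      { adm    = admF
      ; least  = least Sign.+ F admF F≤ min Sign.+
      ; least⁻ = least Sign.+ F admF F≤ min Sign.-
      ; small  = small Sign.+ F admF F≤ min Sign.+
      ; small⁻ = small Sign.+ F admF F≤ min Sign.-
      }
    conclude ((Sign.- , F) , (admF , F≤) , min) = F , inj₂ record
      { adm    = admF
      ; least  = least Sign.- F admF F≤ min Sign.-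
      ; least⁻ = λ {Y} → subst (λ T → Adm k T Y → ∣ F ⊙ inv S ∣ + ∣ Y ∣ ≤ ∣ Y ⊙ T ∣ + ∣ F ∣)
                   (sym (inv-involutive S)) (least Sign.- F admF F≤ min Sign.+)
      ; small  = small Sign.- F admF F≤ min Sign.-
      ; small⁻ = λ {Y} → subst (λ T → Adm k T Y → ∣ Y ⊙ T ∣ + ∣ F ∣ ≤ ∣ F ⊙ inv S ∣ + ∣ Y ∣ → ∣ F ∣ ≤ ∣ Y ∣)
                   (sym (inv-involutive S)) (small Sign.- F admF F≤ min Sign.+)
      }

  atom-resp : ∀ {k S F F′} → ∣ F′ ∣ ≡ ∣ F ∣ → ∣ F′ ⊙ S ∣ ≡ ∣ F ⊙ S ∣ → ∣ F′ ⋆ S ∣ ≡ ∣ F ⋆ S ∣ →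
    IsAtom k S F → IsAtom k S F′
  atom-resp e₁ e₂ e₃ atom = record
    { adm    = subst₂ (λ a b → _ ≤ a × _ ≤ b) (sym e₁) (sym e₃) adm
    ; least  = λ {Y} → subst₂ (λ a b → Adm _ _ Y → b + ∣ Y ∣ ≤ ∣ Y ⊙ _ ∣ + a) (sym e₁) (sym e₂) least
    ; least⁻ = λ {Y} → subst₂ (λ a b → Adm _ (inv _) Y → b + ∣ Y ∣ ≤ ∣ Y ⊙ inv _ ∣ + a) (sym e₁) (sym e₂) least⁻
    ; small  = λ {Y} → subst₂ (λ a b → Adm _ _ Y → ∣ Y ⊙ _ ∣ + a ≤ b + ∣ Y ∣ → a ≤ ∣ Y ∣) (sym e₁) (sym e₂) small
    ; small⁻ = λ {Y} → subst₂ (λ a b → Adm _ (inv _) Y → ∣ Y ⊙ inv _ ∣ + a ≤ b + ∣ Y ∣ → a ≤ ∣ Y ∣) (sym e₁) (sym e₂) small⁻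
    }
    where open IsAtom atom

  atom-◂ : ∀ {k S F} g → IsAtom k S F → IsAtom k S (g ◂ F)
  atom-◂ {S = S} {F} g = atom-resp (∣◂∣ g F) (∣◂⊙∣ g F S) (∣◂⋆∣ g F S)

  ⋆-adm : ∀ {k S X} → Adm k S X → Adm k (inv S) (X ⋆ S)
  ⋆-adm {X = X} (k≤X , k≤X⋆) = k≤X⋆ , ≤-trans k≤X (p⊆q⇒∣p∣≤∣q∣ λ {x} x∈X →
    x∉p⇒x∈∁p λ x∈ → x∈∁p⇒x∉p (⋆⊙inv⊆∁ x∈) x∈X)

  -- The excess does not grow from X to the complement of XS.
  ⋆-excess : ∀ {S} X → ∣ (X ⋆ S) ⊙ inv S ∣ + ∣ X ∣ ≤ ∣ X ⊙ S ∣ + ∣ X ⋆ S ∣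
  ⋆-excess {S} X = begin
    ∣ (X ⋆ S) ⊙ inv S ∣ + ∣ X ∣  ≤⟨ +-monoˡ-≤ ∣ X ∣ (p⊆q⇒∣p∣≤∣q∣ ⋆⊙inv⊆∁) ⟩
    ∣ ∁ X ∣ + ∣ X ∣              ≡⟨ +-comm ∣ ∁ X ∣ ∣ X ∣ ⟩
    ∣ X ∣ + ∣ ∁ X ∣              ≡⟨ ∣p∣+∣∁p∣ X ⟩
    n                            ≡⟨ ∣⊙∣+∣⋆∣ X S ⟨
    ∣ X ⊙ S ∣ + ∣ X ⋆ S ∣        ∎
    where open ≤-Reasoning

  ∣atom∣≤∣⋆∣ : ∀ {k S F X} → IsAtom k S F → Adm k S X →
    ∣ X ⊙ S ∣ + ∣ F ∣ ≤ ∣ F ⊙ S ∣ + ∣ X ∣ → ∣ F ∣ ≤ ∣ X ⋆ S ∣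
  ∣atom∣≤∣⋆∣ {k} {S} {F} {X} atom admX h = small⁻ (⋆-adm admX)
    (arith (∣ (X ⋆ S) ⊙ inv S ∣) (∣ X ∣) (∣ X ⊙ S ∣) (∣ X ⋆ S ∣) (∣ F ∣) (∣ F ⊙ S ∣) (⋆-excess X) h)
    where
    open IsAtom atom
    arith : ∀ d x xs x⋆ f fs → d + x ≤ xs + x⋆ → xs + f ≤ fs + x → d + f ≤ fs + x⋆
    arith d x xs x⋆ f fs h₁ h₂ = lin 0 (h₁ ⊕ h₂) (solve (d ∷ x ∷ xs ∷ x⋆ ∷ f ∷ fs ∷ []))

  -- Intersection and union of two atoms sharing k elements are admissible,
  -- because an atom is no larger than the complement of its product; by
  -- submodularity the intersection then has minimal excess.
  atoms-meet⇒⊆ : ∀ {k S F₁ F₂} → IsAtom k S F₁ → IsAtom k S F₂ → k ≤ ∣ F₁ ∩ F₂ ∣ → F₁ ⊆ F₂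
  atoms-meet⇒⊆ {k} {S} {F₁} {F₂} atom₁ atom₂ k≤P x∈F₁ =
    p∩q⊆q F₁ F₂ (⊆∧∣∣≥⇒⊇ (p∩q⊆p F₁ F₂) (A₁.small admP P-excess) x∈F₁)
    where
    module A₁ = IsAtom atom₁
    module A₂ = IsAtom atom₂
    P = F₁ ∩ F₂
    Q = F₁ ∪ F₂

    sizes : ∣ Q ∣ + ∣ P ∣ ≡ ∣ F₁ ∣ + ∣ F₂ ∣
    sizes = ∣p∪q∣+∣p∩q∣ F₁ F₂

    admP : Adm k S P
    admP = k≤P , ≤-trans (proj₂ A₁.adm) (p⊆q⇒∣p∣≤∣q∣ (⋆-antitone (p∩q⊆p F₁ F₂)))

    F₁≤F₂ : ∣ F₁ ∣ ≤ ∣ F₂ ∣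
    F₁≤F₂ = A₁.small A₂.adm (A₂.least A₁.adm)

    P≤Q⋆ : ∣ P ∣ ≤ ∣ Q ⋆ S ∣
    P≤Q⋆ = arith (∣ P ∣) (∣ P ⊙ S ∣) (∣ Q ⊙ S ∣) (∣ Q ⋆ S ∣) (∣ F₁ ∣) (∣ F₁ ⊙ S ∣) (∣ F₂ ∣) (∣ F₂ ⊙ S ∣) (∣ F₂ ⋆ S ∣)
      (submodular F₁ F₂ S) (A₁.least admP) (≤-trans F₁≤F₂ (∣atom∣≤∣⋆∣ atom₂ A₂.adm ≤-refl))
      (≤-reflexive (trans (∣⊙∣+∣⋆∣ F₂ S) (sym (∣⊙∣+∣⋆∣ Q S))))
      where
      arith : ∀ p ps qs q⋆ f₁ f₁s f₂ f₂s f₂⋆ → qs + ps ≤ f₁s + f₂s → f₁s + p ≤ ps + f₁ →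
        f₁ ≤ f₂⋆ → f₂s + f₂⋆ ≤ qs + q⋆ → p ≤ q⋆
      arith p ps qs q⋆ f₁ f₁s f₂ f₂s f₂⋆ h₁ h₂ h₃ h₄ = lin 0 (h₁ ⊕ h₂ ⊕ h₃ ⊕ h₄)
        (solve (p ∷ ps ∷ qs ∷ q⋆ ∷ f₁ ∷ f₁s ∷ f₂s ∷ f₂⋆ ∷ []))

    admQ : Adm k S Q
    admQ = ≤-trans (proj₁ A₁.adm) (∣p∣≤∣p∪q∣ F₁ F₂) , ≤-trans k≤P P≤Q⋆

    P-excess : ∣ P ⊙ S ∣ + ∣ F₁ ∣ ≤ ∣ F₁ ⊙ S ∣ + ∣ P ∣
    P-excess = arith (∣ P ∣) (∣ P ⊙ S ∣) (∣ Q ∣) (∣ Q ⊙ S ∣) (∣ F₁ ∣) (∣ F₁ ⊙ S ∣) (∣ F₂ ∣) (∣ F₂ ⊙ S ∣)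
      (submodular F₁ F₂ S) (A₂.least admQ) (≤-reflexive (sym sizes))
      where
      arith : ∀ p ps q qs f₁ f₁s f₂ f₂s → qs + ps ≤ f₁s + f₂s → f₂s + q ≤ qs + f₂ →
        f₁ + f₂ ≤ q + p → ps + f₁ ≤ f₁s + p
      arith p ps q qs f₁ f₁s f₂ f₂s h₁ h₂ h₃ = lin 0 (h₁ ⊕ h₂ ⊕ h₃)
        (solve (p ∷ ps ∷ q ∷ qs ∷ f₁ ∷ f₁s ∷ f₂ ∷ f₂s ∷ []))

  -- Blocks and subgroups

  record Subgroup (K : Subset n) : Set where
    field
      ε∈ : ε ∈ K
      ∙∈ : ∀ {x y} → x ∈ K → y ∈ K → x ∙ y ∈ K
      ⁻¹∈ : ∀ {x} → x ∈ K → x ⁻¹ ∈ K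

  -- A set containing ε is a subgroup if its left translates that meet it
  -- contain it.
  block⇒Subgroup : ∀ {X} → ε ∈ X → (∀ g → Nonempty (X ∩ g ◂ X) → X ⊆ g ◂ X) → Subgroup X
  block⇒Subgroup {X} ε∈X block = record
    { ε∈  = ε∈X
    ; ∙∈  = λ {x} {y} x∈ y∈ → ⊆∧∣∣≥⇒⊇ (X⊆xX x∈) (≤-reflexive (∣◂∣ x X)) (∈◂⁺ y∈)
    ; ⁻¹∈ = λ {x} x∈ → subst (_∈ X) (identityʳ (x ⁻¹)) (∈◂⁻ (X⊆xX x∈ ε∈X))
    }
    where
    X⊆xX : ∀ {x} → x ∈ X → X ⊆ x ◂ X
    X⊆xX {x} x∈ = block x (x , x∈p∩q⁺ (x∈ , subst (_∈ x ◂ X) (identityʳ x) (∈◂⁺ ε∈X)))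

  cosets-disjoint : ∀ {K t} → Subgroup K → t ∉ K → ∀ {x} → x ∈ K → x ∉ K ▸ t
  cosets-disjoint {K} {t} K-subgroup t∉ {x} x∈ x∈Kt = t∉ (subst (_∈ K)
    (trans (cong (_∙ x) (⁻¹-anti-homo-∙ x (t ⁻¹))) (trans (xy⁻¹∙y≡x (t ⁻¹ ⁻¹) x) (⁻¹-involutive t)))
    (∙∈ (⁻¹∈ (∈▸⁻ x∈Kt)) x∈))
    where open Subgroup K-subgroup

  -- KT contains the cosets K and Kt.
  2∣K∣≤∣K⊙T∣ : ∀ {K T t} → Subgroup K → ε ∈ T → t ∈ T → t ∉ K → ∣ K ∣ + ∣ K ∣ ≤ ∣ K ⊙ T ∣
  2∣K∣≤∣K⊙T∣ {K} {T} {t} K-subgroup ε∈T t∈ t∉ = begin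
    ∣ K ∣ + ∣ K ∣      ≡⟨ cong (∣ K ∣ +_) (∣▸∣ K t) ⟨
    ∣ K ∣ + ∣ K ▸ t ∣  ≤⟨ disjoint⇒∣∪∣ (cosets-disjoint K-subgroup t∉) ⟩
    ∣ K ∪ K ▸ t ∣      ≤⟨ p⊆q⇒∣p∣≤∣q∣ inside-KT ⟩
    ∣ K ⊙ T ∣          ∎
    where
    open ≤-Reasoning
    inside-KT : K ∪ K ▸ t ⊆ K ⊙ T
    inside-KT {z} z∈ with x∈p∪q⁻ K (K ▸ t) z∈
    ... | inj₁ z∈K  = X⊆X⊙A ε∈T z∈K
    ... | inj₂ z∈Kt = subst (_∈ K ⊙ T) (xy⁻¹∙y≡x z t) (∈⊙⁺ (∈▸⁻ z∈Kt) t∈)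

  ε∈x⁻¹◂ : ∀ {X x} → x ∈ X → ε ∈ x ⁻¹ ◂ X
  ε∈x⁻¹◂ {X} {x} x∈ = subst (_∈ x ⁻¹ ◂ X) (inverseˡ x) (∈◂⁺ x∈)

  -- A translate of a 1-atom is a subgroup.
  1-atom⇒Subgroup : ∀ {S F} → IsAtom 1 S F → ∃ λ K → IsAtom 1 S K × Subgroup K
  1-atom⇒Subgroup {S} {F} atom with 1≤∣∣⇒Nonempty F (proj₁ (IsAtom.adm atom))
  ... | x , x∈ = x ⁻¹ ◂ F , atom′ , block⇒Subgroup (ε∈x⁻¹◂ x∈) λ g meet →
      atoms-meet⇒⊆ atom′ (atom-◂ g atom′) (∈⇒1≤∣∣ (proj₂ meet))
    where
    atom′ : IsAtom 1 S (x ⁻¹ ◂ F)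
    atom′ = atom-◂ (x ⁻¹) atom

  -- Generation

  -- X is closed under right multiplication by A.
  Closed : Subset n → Subset n → Set
  Closed A X = X ⊙ A ⊆ X

  -- A generates the group: as the group is finite, this amounts to every
  -- nonempty set closed under right multiplication by A being everything.
  Generates : Subset n → Set
  Generates A = ∀ {X} → Nonempty X → Closed A X → ∀ x → x ∈ X

  -- The subgroup generated by A, as the smallest nonempty set closed under
  -- right multiplication by A.
  generated : ∀ A → ∃ λ K → Subgroup K × Closed A K × (∀ X → Nonempty X → Closed A X → ∣ K ∣ ≤ ∣ X ∣)
  generated A = K , block⇒Subgroup (ε∈x⁻¹◂ (proj₂ X₀-nonempty)) block , K-closed , K-least
    where
    closed-◂ : ∀ {g X} → Closed A X → Closed A (g ◂ X)
    closed-◂ closed z∈ = ∈◂⁺′ (closed (∈◂⁻ (◂-⊙⊆ z∈)))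

    smallest : ∃ λ X → (Nonempty X × Closed A X) × (∀ Y → Nonempty Y × Closed A Y → ∣ X ∣ ≤ ∣ Y ∣)
    smallest = argmin subsets-searchable (λ X → nonempty? X ×-dec (X ⊙ A ⊆? X)) ∣_∣
      (⊤ , (ε , ∈⊤) , λ _ → ∈⊤)

    X₀ = proj₁ smallest
    X₀-nonempty = proj₁ (proj₁ (proj₂ smallest))
    K = proj₁ X₀-nonempty ⁻¹ ◂ X₀

    K-closed : Closed A K
    K-closed = closed-◂ (proj₂ (proj₁ (proj₂ smallest)))

    K-least : ∀ X → Nonempty X → Closed A X → ∣ K ∣ ≤ ∣ X ∣
    K-least X ne closed = ≤-trans (≤-reflexive (∣◂∣ _ X₀)) (proj₂ (proj₂ smallest) X (ne , closed))

    block : ∀ g → Nonempty (K ∩ g ◂ K) → K ⊆ g ◂ K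
    block g ne x∈ = p∩q⊆q K (g ◂ K) (⊆∧∣∣≥⇒⊇ (p∩q⊆p K (g ◂ K)) (K-least _ ne λ z∈ → x∈p∩q⁺
      ( K-closed (⊙-monoˡ (p∩q⊆p K (g ◂ K)) z∈)
      , closed-◂ K-closed (⊙-monoˡ (p∩q⊆q K (g ◂ K)) z∈))) x∈)

  -- For a generating set A containing ε, every U with UA ≠ G satisfies
  -- |UA| - |U| ≥ |A| / 2: the least excess is attained, for A or for its set
  -- of inverses, by a subgroup K, and KA contains two cosets of K.
  Generates⇒excess : ∀ {A} → ε ∈ A → Generates A → ∀ {U} → Nonempty U → 1 ≤ ∣ U ⋆ A ∣ →
    ∣ A ∣ + (∣ U ∣ + ∣ U ∣) ≤ ∣ U ⊙ A ∣ + ∣ U ⊙ A ∣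
  Generates⇒excess {A} ε∈A generates {U} ne U⋆ = conclude (proj₂ (atom-exists admU))
    where
    admU : Adm 1 A U
    admU = ∈⇒1≤∣∣ (proj₂ ne) , U⋆

    module _ {T K : Subset n} (atom : IsAtom 1 T K) (K-subgroup : Subgroup K) (ε∈T : ε ∈ T)
      (T⊆K⇒A⊆K : T ⊆ K → A ⊆ K) where
      open Subgroup K-subgroup

      escape : ∃ λ t → t ∈ T × t ∉ K
      escape with any? (λ t → (t ∈? T) ×-dec ¬? (t ∈? K))
      ... | yes found = found
      ... | no none with 1≤∣∣⇒Nonempty (K ⋆ T) (proj₂ (IsAtom.adm atom))
      ...   | z , z∈ = contradiction (X⊆X⊙A ε∈T (generates (ε , ε∈) K-closed z)) (x∈∁p⇒x∉p z∈)
        where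
        K-closed : Closed A K
        K-closed w∈ with ∈⊙⁻ w∈
        ... | x , a , x∈ , a∈ , refl = ∙∈ x∈ (T⊆K⇒A⊆K (λ {t} t∈ →
          decidable-stable (t ∈? K) λ t∉ → none (t , t∈ , t∉)) a∈)

      bound : ∣ K ⊙ T ∣ + ∣ U ∣ ≤ ∣ U ⊙ A ∣ + ∣ K ∣ →
        ∣ T ∣ + (∣ U ∣ + ∣ U ∣) ≤ ∣ U ⊙ A ∣ + ∣ U ⊙ A ∣
      bound h = arith (∣ T ∣) (∣ U ∣) (∣ U ⊙ A ∣) (∣ K ∣) (∣ K ⊙ T ∣) h
        (2∣K∣≤∣K⊙T∣ K-subgroup ε∈T (proj₁ (proj₂ escape)) (proj₂ (proj₂ escape))) (p⊆q⇒∣p∣≤∣q∣ λ {t} t∈ →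
        subst (_∈ K ⊙ T) (identityˡ t) (∈⊙⁺ ε∈ t∈))
        where
        arith : ∀ t u ua k kt → kt + u ≤ ua + k → k + k ≤ kt → t ≤ kt → t + (u + u) ≤ ua + ua
        arith t u ua k kt h₁ h₂ h₃ = lin 0 (h₁ ⊕ h₁ ⊕ h₂ ⊕ h₃) (solve (t ∷ u ∷ ua ∷ k ∷ kt ∷ []))

    conclude : ∀ {F} → IsAtom 1 A F ⊎ IsAtom 1 (inv A) F →
      ∣ A ∣ + (∣ U ∣ + ∣ U ∣) ≤ ∣ U ⊙ A ∣ + ∣ U ⊙ A ∣
    conclude (inj₁ atom) = direct (1-atom⇒Subgroup atom)
      where
      direct : (∃ λ K → IsAtom 1 A K × Subgroup K) → ∣ A ∣ + (∣ U ∣ + ∣ U ∣) ≤ ∣ U ⊙ A ∣ + ∣ U ⊙ A ∣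
      direct (K , atomK , K-subgroup) = bound atomK K-subgroup ε∈A (λ A⊆K → A⊆K) (IsAtom.least atomK admU)
    conclude (inj₂ atom) = inverted (1-atom⇒Subgroup atom)
      where
      module _ {K : Subset n} (atomK : IsAtom 1 (inv A) K) (K-subgroup : Subgroup K) where
        A⁻¹⊆K⇒A⊆K : inv A ⊆ K → A ⊆ K
        A⁻¹⊆K⇒A⊆K A⁻¹⊆K {a} a∈ =
          subst (_∈ K) (⁻¹-involutive a) (Subgroup.⁻¹∈ K-subgroup (A⁻¹⊆K (∈inv⁺ a∈)))

        least : ∣ K ⊙ inv A ∣ + ∣ U ∣ ≤ ∣ U ⊙ A ∣ + ∣ K ∣
        least = subst (λ T → Adm 1 T U → ∣ K ⊙ inv A ∣ + ∣ U ∣ ≤ ∣ U ⊙ T ∣ + ∣ K ∣) (inv-involutive A)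
          (IsAtom.least⁻ atomK) admU

        inv-bound : ∣ inv A ∣ + (∣ U ∣ + ∣ U ∣) ≤ ∣ U ⊙ A ∣ + ∣ U ⊙ A ∣
        inv-bound = bound atomK K-subgroup (subst (_∈ inv A) ε⁻¹≈ε (∈inv⁺ ε∈A)) A⁻¹⊆K⇒A⊆K least

      inverted : (∃ λ K → IsAtom 1 (inv A) K × Subgroup K) → ∣ A ∣ + (∣ U ∣ + ∣ U ∣) ≤ ∣ U ⊙ A ∣ + ∣ U ⊙ A ∣
      inverted (K , atomK , K-subgroup) =
        subst (λ a → a + (∣ U ∣ + ∣ U ∣) ≤ ∣ U ⊙ A ∣ + ∣ U ⊙ A ∣) (∣inv∣ A) (inv-bound atomK K-subgroup)

  -- Small products

  -- Every nonempty X with XS ≠ G satisfies |XS| ≥ |X| + |S| - 1.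
  CauchyDavenport : Subset n → Set
  CauchyDavenport S = ∀ {X} → Nonempty X → 1 ≤ ∣ X ⋆ S ∣ → ∣ X ∣ + ∣ S ∣ ≤ suc ∣ X ⊙ S ∣

  -- X is small if |XS| ≤ |X| + |S| - 1.
  Small : Subset n → Subset n → Set
  Small S X = suc ∣ X ⊙ S ∣ ≤ ∣ X ∣ + ∣ S ∣

  -- Small sets that meet have a small union, whose product with S may well
  -- be everything.
  small-∪ : ∀ {S X Y} → CauchyDavenport S → Small S X → Small S Y → Nonempty (X ∩ Y) → 1 ≤ ∣ Y ⋆ S ∣ →
    Small S (X ∪ Y)
  small-∪ {S} {X} {Y} cd smallX smallY meet Y⋆ =
    arith (∣ S ∣) (∣ X ∣) (∣ X ⊙ S ∣) (∣ Y ∣) (∣ Y ⊙ S ∣) (∣ X ∪ Y ∣) (∣ (X ∪ Y) ⊙ S ∣) (∣ X ∩ Y ∣) (∣ (X ∩ Y) ⊙ S ∣)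
      (submodular X Y S) (cd meet (≤-trans Y⋆ (p⊆q⇒∣p∣≤∣q∣ (⋆-antitone (p∩q⊆q X Y))))) smallX smallY
      (≤-reflexive (sym (∣p∪q∣+∣p∩q∣ X Y)))
    where
    arith : ∀ s x xs y ys u us p ps → us + ps ≤ xs + ys → p + s ≤ 1 + ps → 1 + xs ≤ x + s → 1 + ys ≤ y + s →
      x + y ≤ u + p → 1 + us ≤ u + s
    arith s x xs y ys u us p ps h₁ h₂ h₃ h₄ h₅ = lin 0 (h₁ ⊕ h₂ ⊕ h₃ ⊕ h₄ ⊕ h₅)
      (solve (s ∷ x ∷ xs ∷ y ∷ ys ∷ u ∷ us ∷ p ∷ ps ∷ []))

  -- If A is small and contains ε, then the subgroup K generated by A is
  -- small: it is reached by attaching left translates of A one after another.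
  generated-small : ∀ {S A K} → CauchyDavenport S → ε ∈ A → Small S A → 1 ≤ ∣ A ⋆ S ∣ → Subgroup K → Closed A K →
    (∀ X → Nonempty X → Closed A X → ∣ K ∣ ≤ ∣ X ∣) → Small S K
  generated-small {S} {A} {K} cd ε∈A smallA A⋆ K-subgroup K-closed K-least = subst (Small S) Y≡K Y-small
    where
    open Subgroup K-subgroup

    A⊆K : A ⊆ K
    A⊆K {a} a∈ = K-closed (subst (_∈ K ⊙ A) (identityˡ a) (∈⊙⁺ ε∈ a∈))

    P : Subset n → Set
    P Y = A ⊆ Y × Y ⊆ K × Small S Y

    largest : ∃ λ Y → P Y × (∀ Z → P Z → ∣ ∁ Y ∣ ≤ ∣ ∁ Z ∣)
    largest = argmin subsets-searchable (λ Y → (A ⊆? Y) ×-dec (Y ⊆? K) ×-dec (_ ≤? _)) (∣_∣ ∘ ∁)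
      (A , id , A⊆K , smallA)

    Y = proj₁ largest
    A⊆Y : A ⊆ Y
    A⊆Y = proj₁ (proj₁ (proj₂ largest))
    Y⊆K : Y ⊆ K
    Y⊆K = proj₁ (proj₂ (proj₁ (proj₂ largest)))
    Y-small = proj₂ (proj₂ (proj₁ (proj₂ largest)))

    Y-closed : Closed A Y
    Y-closed z∈ with ∈⊙⁻ z∈
    ... | y , a , y∈ , a∈ , refl = decidable-stable (y ∙ a ∈? Y) λ ya∉ →
      <⇒≱ (p⊂q⇒∣p∣<∣q∣ (p⊆q⇒∁p⊇∁q (p⊆p∪q {p = Y} (y ◂ A)) , y ∙ a , x∉p⇒x∈∁p ya∉ ,
            λ ya∈ → x∈∁p⇒x∉p ya∈ (q⊆p∪q Y (y ◂ A) (∈◂⁺ a∈))))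
          (proj₂ (proj₂ largest) (Y ∪ y ◂ A)
            ( (λ x∈ → p⊆p∪q (y ◂ A) (A⊆Y x∈))
            , (λ x∈ → case x∈p∪q⁻ Y (y ◂ A) x∈ of λ where
                (inj₁ x∈Y)  → Y⊆K x∈Y
                (inj₂ x∈yA) → subst (_∈ K) (x∙x⁻¹y≡y y _) (∙∈ (Y⊆K y∈) (A⊆K (∈◂⁻ x∈yA))))
            , small-∪ cd Y-small
                (subst₂ (λ a b → suc b ≤ a + ∣ S ∣) (sym (∣◂∣ y A)) (sym (∣◂⊙∣ y A S)) smallA)
                (y , x∈p∩q⁺ (y∈ , subst (_∈ y ◂ A) (identityʳ y) (∈◂⁺ ε∈A)))
                (subst (1 ≤_) (sym (∣◂⋆∣ y A S)) A⋆)))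

    Y≡K : Y ≡ K
    Y≡K = ⊆-antisym Y⊆K (⊆∧∣∣≥⇒⊇ Y⊆K (K-least Y (ε , A⊆Y ε∈A) Y-closed))

  -- Geometric progressions

  -- The power aⁱ.
  pow : Fin n → ℕ → Fin n
  pow a zero    = ε
  pow a (suc i) = a ∙ pow a i

  -- S consists of the elements y, ay, a²y, …, one for each index below |S|.
  Progression : Subset n → Set
  Progression S = ∃₂ λ a y →
    (∀ {x} → x ∈ S → ∃ λ i → i < ∣ S ∣ × x ≡ pow a i ∙ y) ×
    (∀ i → i < ∣ S ∣ → pow a i ∙ y ∈ S)

  -- If {1, a} generates G and aS has at most one element outside S, then S
  -- is a progression: it is followed from an element y with a⁻¹y outside S.
  two-element⇒Progression : ∀ {S A} → ε ∈ A → ∣ A ∣ ≡ 2 → Generates A → Small S A → 1 ≤ ∣ A ⋆ S ∣ →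
    Nonempty S → Progression S
  two-element⇒Progression {S} {A} ε∈A ∣A∣≡2 generates smallA A⋆ S-nonempty =
    a , y , (λ x∈ → let (i , x≡) = ∈⟪⟫⁻ (first? ∣ S ∣) (S⊆first x∈) in toℕ i , toℕ<n i , x≡) , run
    where
    other : ∃ λ a → a ∈ A × a ∉ ⁅ ε ⁆
    other = ∣∣<⇒∃∉ A ⁅ ε ⁆ (≤-reflexive (trans (cong suc (∣⁅x⁆∣≡1 ε)) (sym ∣A∣≡2)))

    a = proj₁ other
    a∈A : a ∈ A
    a∈A = proj₁ (proj₂ other)

    A⊆ε,a : A ⊆ ⁅ ε ⁆ ∪ ⁅ a ⁆
    A⊆ε,a = ⊆∧∣∣≥⇒⊇ (λ {x} x∈ → case x∈p∪q⁻ ⁅ ε ⁆ ⁅ a ⁆ x∈ of λ where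
        (inj₁ x≡) → subst (_∈ A) (sym (x∈⁅y⁆⇒x≡y ε x≡)) ε∈A
        (inj₂ x≡) → subst (_∈ A) (sym (x∈⁅y⁆⇒x≡y a x≡)) a∈A)
      (≤-trans (≤-reflexive ∣A∣≡2) (≢⇒2≤∣∣ (x∈p∪q⁺ (inj₁ (x∈⁅x⁆ ε))) (x∈p∪q⁺ (inj₂ (x∈⁅x⁆ a)))
        λ ε≡a → proj₂ (proj₂ other) (subst (_∈ ⁅ ε ⁆) ε≡a (x∈⁅x⁆ ε))))

    backward-closed⇒all : ∀ {Z} → Nonempty Z → (∀ {x} → x ∈ Z → a ⁻¹ ∙ x ∈ Z) → ∀ x → x ∈ Z
    backward-closed⇒all {Z} (z , z∈) back x = subst (_∈ Z) (⁻¹-involutive x)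
      (∈inv⁻ (generates (z ⁻¹ , ∈inv⁺ z∈) closed (x ⁻¹)))
      where
      closed : Closed A (inv Z)
      closed w∈ with ∈⊙⁻ w∈
      ... | u , b , u∈ , b∈ , refl with x∈p∪q⁻ ⁅ ε ⁆ ⁅ a ⁆ (A⊆ε,a b∈)
      ...   | inj₁ b≡ = subst (_∈ inv Z) (trans (sym (identityʳ u)) (cong (u ∙_) (sym (x∈⁅y⁆⇒x≡y ε b≡)))) u∈
      ...   | inj₂ b≡ = subst (_∈ inv Z)
        (trans (⁻¹-anti-homo-∙ (a ⁻¹) (u ⁻¹)) (trans (cong₂ _∙_ (⁻¹-involutive u) (⁻¹-involutive a))
          (cong (u ∙_) (sym (x∈⁅y⁆⇒x≡y a b≡)))))
        (∈inv⁺ (back (∈inv⁻ u∈)))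

    forward-closed⇒all : ∀ {Z} → Nonempty Z → (∀ {x} → x ∈ Z → a ∙ x ∈ Z) → ∀ x → x ∈ Z
    forward-closed⇒all {Z} (z , z∈) forth x = decidable-stable (x ∈? Z) λ x∉ →
      x∈∁p⇒x∉p (backward-closed⇒all (x , x∉p⇒x∈∁p x∉) (λ {w} w∈ → x∉p⇒x∈∁p λ a⁻¹w∈ →
        x∈∁p⇒x∉p w∈ (subst (_∈ Z) (x∙x⁻¹y≡y a w) (forth a⁻¹w∈))) z) z∈

    S⊆AS : S ⊆ A ⊙ S
    S⊆AS {x} x∈ = subst (_∈ A ⊙ S) (identityˡ x) (∈⊙⁺ ε∈A x∈)

    one-exit : ∣ A ⊙ S ∩ ∁ S ∣ ≤ 1
    one-exit = arith (∣ A ⊙ S ∩ ∁ S ∣) (∣ A ⊙ S ∣) (∣ S ∣)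
      (≤-trans (disjoint⇒∣∪∣ λ x∈S x∈ → x∈∁p⇒x∉p (p∩q⊆q (A ⊙ S) (∁ S) x∈) x∈S)
        (p⊆q⇒∣p∣≤∣q∣ λ {x} x∈ → case x∈p∪q⁻ S (A ⊙ S ∩ ∁ S) x∈ of λ where
          (inj₁ x∈S) → S⊆AS x∈S
          (inj₂ x∈D) → p∩q⊆p (A ⊙ S) (∁ S) x∈D))
      (subst (λ k → suc ∣ A ⊙ S ∣ ≤ k + ∣ S ∣) ∣A∣≡2 smallA)
      where
      arith : ∀ d p s → s + d ≤ p → 1 + p ≤ 2 + s → d ≤ 1
      arith d p s h₁ h₂ = lin 0 (h₁ ⊕ h₂) (solve (d ∷ p ∷ s ∷ []))

    exit-unique : ∀ {x x'} → x ∈ S → x' ∈ S → a ∙ x ∉ S → a ∙ x' ∉ S → x ≡ x'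
    exit-unique x∈ x'∈ ax∉ ax'∉ = ∙-cancelˡ a _ _ (∣∣≤1⇒≡ one-exit
      (x∈p∩q⁺ (∈⊙⁺ a∈A x∈ , x∉p⇒x∈∁p ax∉)) (x∈p∩q⁺ (∈⊙⁺ a∈A x'∈ , x∉p⇒x∈∁p ax'∉)))

    start : ∃ λ y → y ∈ S × a ⁻¹ ∙ y ∉ S
    start with any? (λ y → (y ∈? S) ×-dec ¬? (a ⁻¹ ∙ y ∈? S))
    ... | yes found = found
    ... | no  none with 1≤∣∣⇒Nonempty (A ⋆ S) A⋆
    ...   | z , z∈ = contradiction (S⊆AS (backward-closed⇒all S-nonempty
            (λ {x} x∈ → decidable-stable (a ⁻¹ ∙ x ∈? S) λ a⁻¹x∉ → none (x , x∈ , a⁻¹x∉)) z))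
            (x∈∁p⇒x∉p z∈)

    y = proj₁ start
    y∈S : y ∈ S
    y∈S = proj₁ (proj₂ start)
    a⁻¹y∉S : a ⁻¹ ∙ y ∉ S
    a⁻¹y∉S = proj₂ (proj₂ start)

    first? : ∀ k → Decidable (λ x → ∃ λ (i : Fin k) → x ≡ pow a (toℕ i) ∙ y)
    first? k x = any? λ i → x ≟ᶠ pow a (toℕ i) ∙ y

    -- The set {y, ay, …, aᵏ⁻¹y}.
    first : ℕ → Subset n
    first k = ⟪ first? k ⟫

    ∈first : ∀ {k i} → i < k → pow a i ∙ y ∈ first k
    ∈first {k} i<k = ∈⟪⟫⁺ (first? k) (fromℕ< i<k , cong (λ j → pow a j ∙ y) (sym (toℕ-fromℕ< i<k)))

    ∣first∣≤ : ∀ k → ∣ first k ∣ ≤ k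
    ∣first∣≤ k = subst (∣ first k ∣ ≤_) (∣⊤∣≡n k)
      (injection⇒∣∣≤ (first k) (⊤ {k}) (λ x i → x ≡ pow a (toℕ i) ∙ y)
        (λ x∈ → let (i , x≡) = ∈⟪⟫⁻ (first? k) x∈ in i , ∈⊤ , x≡) λ _ _ x≡ x'≡ → trans x≡ (sym x'≡))

    run : ∀ i → i < ∣ S ∣ → pow a i ∙ y ∈ S
    run zero    _   = subst (_∈ S) (sym (identityˡ y)) y∈S
    run (suc i) i<s = decidable-stable (pow a (suc i) ∙ y ∈? S) λ next∉ → impossible
      λ eq → next∉ (subst (_∈ S) (sym (assoc a (pow a i) y)) eq)
      where
      k = suc i

      impossible : ¬ (a ∙ (pow a i ∙ y) ∉ S)
      impossible exit∉ = x∈∁p⇒x∉p (p∩q⊆q S (∁ (first k)) (forward-closed⇒all rest-nonempty rest-closed y))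
        (subst (_∈ first k) (identityˡ y) (∈first (s≤s z≤n)))
        where
        rest-nonempty : Nonempty (S ∩ ∁ (first k))
        rest-nonempty with ∣∣<⇒∃∉ S (first k) (≤-<-trans (∣first∣≤ k) i<s)
        ... | x , x∈ , x∉ = x , x∈p∩q⁺ (x∈ , x∉p⇒x∈∁p x∉)

        rest-closed : ∀ {x} → x ∈ S ∩ ∁ (first k) → a ∙ x ∈ S ∩ ∁ (first k)
        rest-closed {x} x∈ = x∈p∩q⁺
          ( decidable-stable (a ∙ x ∈? S) (λ ax∉ → x∉first
              (subst (_∈ first k) (exit-unique (run i (<-trans (n<1+n i) i<s)) x∈S exit∉ ax∉) (∈first ≤-refl)))
          , x∉p⇒x∈∁p λ ax∈ → before (∈⟪⟫⁻ (first? k) ax∈))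
          where
          x∈S : x ∈ S
          x∈S = p∩q⊆p S (∁ (first k)) x∈
          x∉first : x ∉ first k
          x∉first = x∈∁p⇒x∉p (p∩q⊆q S (∁ (first k)) x∈)

          before : ¬ (∃ λ (j : Fin k) → a ∙ x ≡ pow a (toℕ j) ∙ y)
          before (zero  , eq) = a⁻¹y∉S (subst (_∈ S)
            (trans (sym (x⁻¹∙xy≡y a x)) (cong (a ⁻¹ ∙_) (trans eq (identityˡ y)))) x∈S)
          before (suc j , eq) = x∉first (subst (_∈ first k)
            (sym (∙-cancelˡ a _ _ (trans eq (assoc a _ y)))) (∈first (m<n⇒m<1+n (toℕ<n j))))

    distinct : ∀ i j → i < j → j < ∣ S ∣ → pow a i ∙ y ≢ pow a j ∙ y
    distinct zero    (suc j) _         j<s eq = a⁻¹y∉S (subst (_∈ S)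
      (trans (sym (x⁻¹∙xy≡y a _)) (cong (a ⁻¹ ∙_) (trans (sym (assoc a _ y)) (trans (sym eq) (identityˡ y)))))
      (run j (<-trans (n<1+n j) j<s)))
    distinct (suc i) (suc j) (s≤s i<j) j<s eq = distinct i j i<j (<-trans (n<1+n j) j<s)
      (∙-cancelˡ a _ _ (trans (sym (assoc a _ y)) (trans eq (assoc a _ y))))

    S⊆first : S ⊆ first ∣ S ∣
    S⊆first = ⊆∧∣∣≥⇒⊇
      (λ x∈ → let (i , x≡) = ∈⟪⟫⁻ (first? ∣ S ∣) x∈ in subst (_∈ S) (sym x≡) (run (toℕ i) (toℕ<n i)))
      (subst (_≤ ∣ first ∣ S ∣ ∣) (∣⊤∣≡n ∣ S ∣)
        (function⇒∣∣≤ (⊤ {∣ S ∣}) (first ∣ S ∣) (λ i → pow a (toℕ i) ∙ y) (λ {i} _ → ∈first (toℕ<n i))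
          λ {i} {j} _ _ eq → case <-cmp (toℕ i) (toℕ j) of λ where
            (tri< i<j _ _) → contradiction eq (distinct _ _ i<j (toℕ<n j))
            (tri≈ _ i≡j _) → toℕ-injective i≡j
            (tri> _ _ j<i) → contradiction (sym eq) (distinct _ _ j<i (toℕ<n i))))

  -- Tangent lines

  -- The left translates gA of a generating 2-atom A with at least three
  -- elements are called lines; two distinct lines share at most one element.
  module LargeAtom {S A : Subset n} (cd : CauchyDavenport S) (atom : IsAtom 2 S A) (ε∈A : ε ∈ A)
    (A-small : Small S A) (generates : Generates A) (S-nonempty : Nonempty S) (3≤∣A∣ : 3 ≤ ∣ A ∣) where

    private
      m s : ℕ
      m = ∣ A ∣
      s = ∣ S ∣

    line-small : ∀ g → Small S (g ◂ A)
    line-small g = subst₂ (λ a b → suc b ≤ a + s) (sym (∣◂∣ g A)) (sym (∣◂⊙∣ g A S)) A-small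

    line-⋆ : ∀ g → 1 ≤ ∣ (g ◂ A) ⋆ S ∣
    line-⋆ g = subst (1 ≤_) (sym (∣◂⋆∣ g A S)) (≤-trans (s≤s z≤n) (proj₂ (IsAtom.adm atom)))

    lines-meet : ∀ g h → 2 ≤ ∣ g ◂ A ∩ h ◂ A ∣ → g ◂ A ⊆ h ◂ A
    lines-meet g h = atoms-meet⇒⊆ (atom-◂ g atom) (atom-◂ h atom)

    small⇒excess≤ : ∀ {X} → Small S X → ∣ X ⊙ S ∣ + m ≤ ∣ A ⊙ S ∣ + ∣ X ∣
    small⇒excess≤ {X} X-small = arith (∣ X ∣) (∣ X ⊙ S ∣) (∣ A ⊙ S ∣) m s X-small
      (cd (ε , ε∈A) (≤-trans (s≤s z≤n) (proj₂ (IsAtom.adm atom))))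
      where
      arith : ∀ x xs as a s → 1 + xs ≤ x + s → a + s ≤ 1 + as → xs + a ≤ as + x
      arith x xs as a s h₁ h₂ = lin 0 (h₁ ⊕ h₂) (solve (x ∷ xs ∷ as ∷ a ∷ s ∷ []))

    small⇒m≤ : ∀ {X} → Adm 2 S X → Small S X → m ≤ ∣ X ∣
    small⇒m≤ admX X-small = IsAtom.small atom admX (small⇒excess≤ X-small)

    small⇒m≤⋆ : ∀ {X} → Adm 2 S X → Small S X → m ≤ ∣ X ⋆ S ∣
    small⇒m≤⋆ admX X-small = ∣atom∣≤∣⋆∣ atom admX (small⇒excess≤ X-small)

    -- A largest admissible small set.
    opaque
      largest : ∃ λ M → (Adm 2 S M × Small S M) × (∀ X → Adm 2 S X × Small S X → ∣ ∁ M ∣ ≤ ∣ ∁ X ∣)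
      largest = argmin subsets-searchable
        (λ X → ((2 ≤? ∣ X ∣) ×-dec (2 ≤? ∣ X ⋆ S ∣)) ×-dec (suc ∣ X ⊙ S ∣ ≤? ∣ X ∣ + s))
        (∣_∣ ∘ ∁) (A , IsAtom.adm atom , A-small)

    M : Subset n
    M = proj₁ largest

    admM : Adm 2 S M
    admM = proj₁ (proj₁ (proj₂ largest))

    M-small : Small S M
    M-small = proj₂ (proj₁ (proj₂ largest))

    M-nonempty : Nonempty M
    M-nonempty = 1≤∣∣⇒Nonempty M (≤-trans (s≤s z≤n) (proj₁ admM))

    M-cd : ∣ M ∣ + s ≤ suc ∣ M ⊙ S ∣
    M-cd = cd M-nonempty (≤-trans (s≤s z≤n) (proj₂ admM))

    -- A line is tangent to M if it meets M without being contained in it.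
    -- Attaching it to M leaves an element outside the product with S, but
    -- not two, as M is largest; hence all sizes are determined.
    module Tangent (g : Fin n) (meets : Nonempty (M ∩ g ◂ A)) (leaves : ¬ g ◂ A ⊆ M) where
      private
        W P : Subset n
        W = M ∪ g ◂ A
        P = M ∩ g ◂ A

      W-small : Small S W
      W-small = small-∪ cd M-small (line-small g) meets (line-⋆ g)

      ∣W⋆∣≤1 : ∣ W ⋆ S ∣ ≤ 1
      ∣W⋆∣≤1 = ≮⇒≥ λ 2≤W⋆ → <⇒≱ ∣∁W∣<∣∁M∣
        (proj₂ (proj₂ largest) W ((≤-trans (proj₁ admM) (∣p∣≤∣p∪q∣ M (g ◂ A)) , 2≤W⋆) , W-small))
        where
        ∣∁W∣<∣∁M∣ : ∣ ∁ W ∣ < ∣ ∁ M ∣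
        ∣∁W∣<∣∁M∣ = ≰⇒> λ ∁M≤∁W → leaves λ x∈gA →
          ⊆∧∣∣≥⇒⊇ {p = M} {q = W} (p⊆p∪q (g ◂ A))
            (arith (∣ W ∣) (∣ ∁ W ∣) (∣ M ∣) (∣ ∁ M ∣) ∁M≤∁W
              (≤-reflexive (trans (∣p∣+∣∁p∣ W) (sym (∣p∣+∣∁p∣ M)))))
            (q⊆p∪q M (g ◂ A) x∈gA)
          where
          arith : ∀ w w′ k k′ → k′ ≤ w′ → w + w′ ≤ k + k′ → w ≤ k
          arith w w′ k k′ h₁ h₂ = lin 0 (h₁ ⊕ h₂) (solve (w ∷ w′ ∷ k ∷ k′ ∷ []))

      sizes : ∣ W ∣ + ∣ P ∣ ≡ ∣ M ∣ + m
      sizes = trans (∣p∪q∣+∣p∩q∣ M (g ◂ A)) (cong (∣ M ∣ +_) (∣◂∣ g A))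

      n≤∣W∣+s : n ≤ ∣ W ∣ + s
      n≤∣W∣+s = arith n (∣ W ⊙ S ∣) (∣ W ⋆ S ∣) (∣ W ∣ + s) (≤-reflexive (sym (∣⊙∣+∣⋆∣ W S))) ∣W⋆∣≤1 W-small
        where
        arith : ∀ n p q r → n ≤ p + q → q ≤ 1 → 1 + p ≤ r → n ≤ r
        arith n p q r h₁ h₂ h₃ = lin 0 (h₁ ⊕ h₂ ⊕ h₃) (solve (n ∷ p ∷ q ∷ r ∷ []))

      ∣M∣+∣M⋆∣+s≤1+n : ∣ M ∣ + ∣ M ⋆ S ∣ + s ≤ 1 + n
      ∣M∣+∣M⋆∣+s≤1+n = arith n (∣ M ∣) (∣ M ⊙ S ∣) (∣ M ⋆ S ∣) s M-cd (≤-reflexive (∣⊙∣+∣⋆∣ M S))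
        where
        arith : ∀ n k p q s → k + s ≤ 1 + p → p + q ≤ n → k + q + s ≤ 1 + n
        arith n k p q s h₁ h₂ = lin 0 (h₁ ⊕ h₂) (solve (n ∷ k ∷ p ∷ q ∷ s ∷ []))

      ∣P∣≤1 : ∣ P ∣ ≤ 1
      ∣P∣≤1 = arith n (∣ W ∣) (∣ P ∣) (∣ M ∣) (∣ M ⋆ S ∣) m s (≤-reflexive sizes) n≤∣W∣+s ∣M∣+∣M⋆∣+s≤1+n
        (small⇒m≤⋆ admM M-small)
        where
        arith : ∀ n w p k q m s → w + p ≤ k + m → n ≤ w + s → k + q + s ≤ 1 + n → m ≤ q → p ≤ 1
        arith n w p k q m s h₁ h₂ h₃ h₄ = lin 0 (h₁ ⊕ h₂ ⊕ h₃ ⊕ h₄) (solve (n ∷ w ∷ p ∷ k ∷ q ∷ m ∷ s ∷ []))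

      ∣M⋆∣≤m : ∣ M ⋆ S ∣ ≤ m
      ∣M⋆∣≤m = arith n (∣ W ∣) (∣ P ∣) (∣ M ∣) (∣ M ⋆ S ∣) m s (≤-reflexive sizes) n≤∣W∣+s ∣M∣+∣M⋆∣+s≤1+n
        (∈⇒1≤∣∣ (proj₂ meets))
        where
        arith : ∀ n w p k q m s → w + p ≤ k + m → n ≤ w + s → k + q + s ≤ 1 + n → 1 ≤ p → q ≤ m
        arith n w p k q m s h₁ h₂ h₃ h₄ = lin 0 (h₁ ⊕ h₂ ⊕ h₃ ⊕ h₄) (solve (n ∷ w ∷ p ∷ k ∷ q ∷ m ∷ s ∷ []))

      1≤∣W⋆∣ : 1 ≤ ∣ W ⋆ S ∣
      1≤∣W⋆∣ = arith n (∣ W ∣) (∣ W ⊙ S ∣) (∣ W ⋆ S ∣) (∣ P ∣) (∣ M ∣) (∣ M ⋆ S ∣) m s (≤-reflexive sizes) W-small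
        (≤-reflexive (sym (∣⊙∣+∣⋆∣ W S))) ∣M∣+∣M⋆∣+s≤1+n (small⇒m≤⋆ admM M-small) (∈⇒1≤∣∣ (proj₂ meets))
        where
        arith : ∀ n w ws w⋆ p k q m s → w + p ≤ k + m → 1 + ws ≤ w + s → n ≤ ws + w⋆ →
          k + q + s ≤ 1 + n → m ≤ q → 1 ≤ p → 1 ≤ w⋆
        arith n w ws w⋆ p k q m s h₁ h₂ h₃ h₄ h₅ h₆ = lin 0 (h₁ ⊕ h₂ ⊕ h₃ ⊕ h₄ ⊕ h₅ ⊕ h₆)
          (solve (n ∷ w ∷ ws ∷ w⋆ ∷ p ∷ k ∷ q ∷ m ∷ s ∷ []))

    -- U collects the g with gA inside M, and T a the g whose line is
    -- tangent to M at ga.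
    U : Subset n
    U = ⟪ (λ g → g ◂ A ⊆? M) ⟫

    T? : ∀ a → Decidable (λ g → g ∙ a ∈ M × ¬ g ◂ A ⊆ M)
    T? a g = (g ∙ a ∈? M) ×-dec ¬? (g ◂ A ⊆? M)

    T : Fin n → Subset n
    T a = ⟪ T? a ⟫

    ∈U⁺ : ∀ {g} → g ◂ A ⊆ M → g ∈ U
    ∈U⁺ = ∈⟪⟫⁺ (λ g → g ◂ A ⊆? M)

    ∈U⁻ : ∀ {g} → g ∈ U → g ◂ A ⊆ M
    ∈U⁻ = ∈⟪⟫⁻ (λ g → g ◂ A ⊆? M)

    UA⊆M : U ⊙ A ⊆ M
    UA⊆M z∈ with ∈⊙⁻ z∈
    ... | g , a , g∈ , a∈ , refl = ∈U⁻ g∈ (∈◂⁺ a∈)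

    ∣M∣≤∣U∣+∣T∣ : ∀ a → ∣ M ∣ ≤ ∣ U ∣ + ∣ T a ∣
    ∣M∣≤∣U∣+∣T∣ a = begin
      ∣ M ∣            ≡⟨ ∣▸∣ M (a ⁻¹) ⟨
      ∣ M ▸ a ⁻¹ ∣     ≤⟨ p⊆q⇒∣p∣≤∣q∣ split ⟩
      ∣ U ∪ T a ∣      ≤⟨ ∣∪∣≤ U (T a) ⟩
      ∣ U ∣ + ∣ T a ∣  ∎
      where
      open ≤-Reasoning
      split : M ▸ a ⁻¹ ⊆ U ∪ T a
      split {g} g∈ with g ◂ A ⊆? M
      ... | yes gA⊆M = x∈p∪q⁺ (inj₁ (∈U⁺ gA⊆M))
      ... | no  gA⊈M = x∈p∪q⁺ (inj₂ (∈⟪⟫⁺ (T? a)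
        (subst (λ b → g ∙ b ∈ M) (⁻¹-involutive a) (∈▸⁻ g∈) , gA⊈M)))

    tangent-point : ∀ {g a} → a ∈ A → g ∈ T a → g ∙ a ∈ M ∩ g ◂ A
    tangent-point a∈ g∈ = x∈p∩q⁺ (proj₁ (∈⟪⟫⁻ (T? _) g∈) , ∈◂⁺ a∈)

    -- The relation between a tangent line gA and the only element z outside
    -- (M ∪ gA)S.  As M ∪ gA is the complement of zS⁻¹, the element determines
    -- the line.
    R : Fin n → Fin n → Set
    R g z = z ∈ (M ∪ g ◂ A) ⋆ S

    R⇒∉zS⁻¹ : ∀ {g z x} → R g z → x ∈ M ∪ g ◂ A → x ∉ z ◂ inv S
    R⇒∉zS⁻¹ {g} {z} {x} gRz x∈ x∈zS⁻¹ = x∈∁p⇒x∉p gRz (subst (_∈ (M ∪ g ◂ A) ⊙ S)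
      (trans (cong (x ∙_) (trans (⁻¹-anti-homo-∙ (z ⁻¹) x) (cong (x ⁻¹ ∙_) (⁻¹-involutive z)))) (x∙x⁻¹y≡y x z))
      (∈⊙⁺ x∈ (∈inv⁻ (∈◂⁻ x∈zS⁻¹))))

    R⇒⊆ : ∀ {g h z a b} → a ∈ A → b ∈ A → g ∈ T a → h ∈ T b → R g z → R h z → h ◂ A ⊆ g ◂ A
    R⇒⊆ {g} {h} {z} {a} {b} a∈ b∈ g∈ h∈ gRz hRz = lines-meet h g
      (arith (∣ h ◂ A ∩ g ◂ A ∣) (∣ M ∩ h ◂ A ∣) m cover Th.∣P∣≤1 3≤∣A∣)
      where
      module Tg = Tangent g (_ , tangent-point a∈ g∈) (proj₂ (∈⟪⟫⁻ (T? a) g∈))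
      module Th = Tangent h (_ , tangent-point b∈ h∈) (proj₂ (∈⟪⟫⁻ (T? b) h∈))

      W W′ : Subset n
      W  = M ∪ g ◂ A
      W′ = M ∪ h ◂ A

      ∣W∪W′∣≤∣W∣ : ∣ W ∪ W′ ∣ ≤ ∣ W ∣
      ∣W∪W′∣≤∣W∣ = +-cancelʳ-≤ s ∣ W ∪ W′ ∣ ∣ W ∣ (begin
        ∣ W ∪ W′ ∣ + s                ≡⟨ cong (∣ W ∪ W′ ∣ +_) (trans (∣◂∣ z (inv S)) (∣inv∣ S)) ⟨
        ∣ W ∪ W′ ∣ + ∣ z ◂ inv S ∣    ≤⟨ disjoint⇒∣∪∣ disjoint ⟩
        ∣ (W ∪ W′) ∪ z ◂ inv S ∣      ≤⟨ ∣p∣≤n ((W ∪ W′) ∪ z ◂ inv S) ⟩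
        n                             ≤⟨ Tg.n≤∣W∣+s ⟩
        ∣ W ∣ + s                     ∎)
        where
        open ≤-Reasoning
        disjoint : ∀ {x} → x ∈ W ∪ W′ → x ∉ z ◂ inv S
        disjoint x∈ with x∈p∪q⁻ W W′ x∈
        ... | inj₁ x∈W  = R⇒∉zS⁻¹ gRz x∈W
        ... | inj₂ x∈W′ = R⇒∉zS⁻¹ hRz x∈W′

      cover : m ≤ ∣ M ∩ h ◂ A ∣ + ∣ h ◂ A ∩ g ◂ A ∣
      cover = subst (_≤ ∣ M ∩ h ◂ A ∣ + ∣ h ◂ A ∩ g ◂ A ∣) (∣◂∣ h A)
        (≤-trans (p⊆q⇒∣p∣≤∣q∣ split) (∣∪∣≤ (M ∩ h ◂ A) (h ◂ A ∩ g ◂ A)))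
        where
        split : h ◂ A ⊆ (M ∩ h ◂ A) ∪ (h ◂ A ∩ g ◂ A)
        split {x} x∈ with x∈p∪q⁻ M (g ◂ A) (⊆∧∣∣≥⇒⊇ {p = W} (p⊆p∪q W′) ∣W∪W′∣≤∣W∣ {x}
                            (q⊆p∪q W W′ (q⊆p∪q M (h ◂ A) x∈)))
        ... | inj₁ x∈M  = x∈p∪q⁺ (inj₁ (x∈p∩q⁺ (x∈M , x∈)))
        ... | inj₂ x∈gA = x∈p∪q⁺ (inj₂ (x∈p∩q⁺ (x∈ , x∈gA)))

      arith : ∀ k p m → m ≤ p + k → p ≤ 1 → 3 ≤ m → 2 ≤ k
      arith k p m h₁ h₂ h₃ = lin 0 (h₁ ⊕ h₂ ⊕ h₃) (solve (k ∷ p ∷ m ∷ []))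

    -- A tangent line exists, since M is not closed under multiplication by A.
    opaque
      tangent : ∃ λ g → ∃ λ x → x ∈ M ∩ g ◂ A × ¬ g ◂ A ⊆ M
      tangent with any? (λ g → nonempty? (M ∩ g ◂ A) ×-dec ¬? (g ◂ A ⊆? M))
      ... | yes (g , (x , x∈) , leaves) = g , x , x∈ , leaves
      ... | no  none with 1≤∣∣⇒Nonempty (M ⋆ S) (≤-trans (s≤s z≤n) (proj₂ admM))
      ...   | z , z∈ = contradiction
        (subst (_∈ M ⊙ S) (xy⁻¹∙y≡x z _) (∈⊙⁺ (generates M-nonempty closed (z ∙ proj₁ S-nonempty ⁻¹)) (proj₂ S-nonempty))) (x∈∁p⇒x∉p z∈)
        where
        closed : Closed A M
        closed w∈ with ∈⊙⁻ w∈
        ... | g , a , g∈ , a∈ , refl = decidable-stable (g ◂ A ⊆? M)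
          (λ leaves → none (g , (g , x∈p∩q⁺ (g∈ , subst (_∈ g ◂ A) (identityʳ g) (∈◂⁺ ε∈A))) , leaves)) (∈◂⁺ a∈)

    private
      module T₀ = Tangent (proj₁ tangent) (proj₁ (proj₂ tangent) , proj₁ (proj₂ (proj₂ tangent)))
        (proj₂ (proj₂ (proj₂ tangent)))

    ∣M∣+m+s≤1+n : ∣ M ∣ + m + s ≤ 1 + n
    ∣M∣+m+s≤1+n = ≤-trans (+-monoˡ-≤ s (+-monoʳ-≤ ∣ M ∣ (small⇒m≤⋆ admM M-small))) T₀.∣M∣+∣M⋆∣+s≤1+n

    n<∣M∣+m+s : 1 + n ≤ ∣ M ∣ + m + s
    n<∣M∣+m+s = arith n (∣ M ∣) (∣ M ⊙ S ∣) (∣ M ⋆ S ∣) m s M-small (≤-reflexive (sym (∣⊙∣+∣⋆∣ M S))) T₀.∣M⋆∣≤m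
      where
      arith : ∀ n k p q m s → 1 + p ≤ k + s → n ≤ p + q → q ≤ m → 1 + n ≤ k + m + s
      arith n k p q m s h₁ h₂ h₃ = lin 0 (h₁ ⊕ h₂ ⊕ h₃) (solve (n ∷ k ∷ p ∷ q ∷ m ∷ s ∷ []))

    -- The elements related to the lines of T a.  They lie outside MS, and for a
    -- and b in distinct right cosets of H the sets I a and I b are disjoint.
    I? : ∀ a → Decidable (λ z → ∃ λ g → g ∈ T a × R g z)
    I? a z = any? λ g → (g ∈? T a) ×-dec (z ∈? (M ∪ g ◂ A) ⋆ S)

    I : Fin n → Subset n
    I a = ⟪ I? a ⟫

    I⊆M⋆ : ∀ a → I a ⊆ M ⋆ S
    I⊆M⋆ a z∈ with ∈⟪⟫⁻ (I? a) z∈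
    ... | g , _ , gRz = ⋆-antitone (p⊆p∪q (g ◂ A)) gRz

    -- A tangent line has only one point in M.
    same-point : ∀ {g h z a b} → a ∈ A → b ∈ A → g ∈ T a → h ∈ T b → R g z → R h z → g ∙ a ≡ h ∙ b
    same-point {g} {h} {a = a} {b} a∈ b∈ g∈ h∈ gRz hRz = ∣∣≤1⇒≡
      (Tangent.∣P∣≤1 g (_ , tangent-point a∈ g∈) (proj₂ (∈⟪⟫⁻ (T? a) g∈)))
      (tangent-point a∈ g∈)
      (x∈p∩q⁺ (proj₁ (∈⟪⟫⁻ (T? b) h∈) , R⇒⊆ a∈ b∈ g∈ h∈ gRz hRz (∈◂⁺ b∈)))

    ∣T∣≤∣I∣ : ∀ {a} → a ∈ A → ∣ T a ∣ ≤ ∣ I a ∣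
    ∣T∣≤∣I∣ {a} a∈ = injection⇒∣∣≤ (T a) (I a) R
      (λ {g} g∈ → let (z , gRz) = 1≤∣∣⇒Nonempty _ (Tangent.1≤∣W⋆∣ g (_ , tangent-point a∈ g∈) (proj₂ (∈⟪⟫⁻ (T? a) g∈)))
                  in z , ∈⟪⟫⁺ (I? a) (g , g∈ , gRz) , gRz)
      λ g∈ h∈ gRz hRz → ∙-cancelʳ a _ _ (same-point a∈ a∈ g∈ h∈ gRz hRz)

    -- The left stabiliser of A; A is a union of right cosets of H.
    H : Subset n
    H = ⟪ (λ h → A ⊆? h ◂ A) ⟫

    ∈H⁺ : ∀ {h} → A ⊆ h ◂ A → h ∈ H
    ∈H⁺ = ∈⟪⟫⁺ (λ h → A ⊆? h ◂ A)

    ∈H⁻ : ∀ {h} → h ∈ H → A ⊆ h ◂ A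
    ∈H⁻ = ∈⟪⟫⁻ (λ h → A ⊆? h ◂ A)

    HA⊆A : ∀ {h x} → h ∈ H → x ∈ A → h ∙ x ∈ A
    HA⊆A {h} h∈ x∈ = ⊆∧∣∣≥⇒⊇ (∈H⁻ h∈) (≤-reflexive (∣◂∣ h A)) (∈◂⁺ x∈)

    H-subgroup : Subgroup H
    H-subgroup = record
      { ε∈  = ∈H⁺ λ {x} x∈ → subst (_∈ ε ◂ A) (identityˡ x) (∈◂⁺ x∈)
      ; ∙∈  = λ {g} {h} g∈ h∈ → ∈H⁺ λ {x} x∈ → ∈◂⁺′ (subst (_∈ A)
                (sym (trans (cong (_∙ x) (⁻¹-anti-homo-∙ g h)) (assoc (h ⁻¹) (g ⁻¹) x)))
                (∈◂⁻ (∈H⁻ h∈ (∈◂⁻ (∈H⁻ g∈ x∈)))))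
      ; ⁻¹∈ = λ {h} h∈ → ∈H⁺ λ {x} x∈ → ∈◂⁺′ (subst (λ k → k ∙ x ∈ A) (sym (⁻¹-involutive h)) (HA⊆A h∈ x∈))
      }
    open Subgroup H-subgroup public using () renaming (ε∈ to ε∈H; ∙∈ to H∙; ⁻¹∈ to H⁻¹)

    H⊆A : H ⊆ A
    H⊆A {h} h∈ = subst (_∈ A) (identityʳ h) (HA⊆A h∈ ε∈A)

    I-disjoint : ∀ {a b} → a ∈ A → b ∈ A → a ∙ b ⁻¹ ∉ H → ∀ {z} → z ∈ I a → z ∉ I b
    I-disjoint {a} {b} a∈ b∈ ab⁻¹∉H z∈Ia z∈Ib with ∈⟪⟫⁻ (I? a) z∈Ia | ∈⟪⟫⁻ (I? b) z∈Ib
    ... | g , g∈ , gRz | h , h∈ , hRz = ab⁻¹∉H (subst (_∈ H) (sym ab⁻¹≡g⁻¹h) (∈H⁺ λ {x} x∈ → ∈◂⁺′ (subst (_∈ A)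
        (sym (trans (cong (_∙ x) (trans (⁻¹-anti-homo-∙ (g ⁻¹) h)
          (cong (h ⁻¹ ∙_) (⁻¹-involutive g)))) (assoc (h ⁻¹) g x)))
        (∈◂⁻ (R⇒⊆ b∈ a∈ h∈ g∈ hRz gRz (∈◂⁺ x∈))))))
      where
      ab⁻¹≡g⁻¹h : a ∙ b ⁻¹ ≡ g ⁻¹ ∙ h
      ab⁻¹≡g⁻¹h = trans (cong (_∙ b ⁻¹) (trans (sym (x⁻¹∙xy≡y g a))
        (cong (g ⁻¹ ∙_) (same-point a∈ b∈ g∈ h∈ gRz hRz))))
        (trans (assoc (g ⁻¹) (h ∙ b) (b ⁻¹)) (cong (g ⁻¹ ∙_) (xy∙y⁻¹≡x h b)))

    -- Otherwise A would be a subgroup, which contradicts that A generates.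
    opaque
      outside-H : ∃ λ a → a ∈ A × a ∉ H
      outside-H with any? (λ a → (a ∈? A) ×-dec ¬? (a ∈? H))
      ... | yes found = found
      ... | no  none with 1≤∣∣⇒Nonempty (A ⋆ S) (≤-trans (s≤s z≤n) (proj₂ (IsAtom.adm atom)))
      ...   | z , z∈ = contradiction
        (subst (_∈ A ⊙ S) (xy⁻¹∙y≡x z _) (∈⊙⁺ (generates (ε , ε∈A) closed (z ∙ proj₁ S-nonempty ⁻¹)) (proj₂ S-nonempty))) (x∈∁p⇒x∉p z∈)
        where
        closed : Closed A A
        closed w∈ with ∈⊙⁻ w∈
        ... | x , y , x∈ , y∈ , refl = HA⊆A (decidable-stable (x ∈? H) λ x∉ → none (x , x∈ , x∉)) y∈

    a : Fin n
    a = proj₁ outside-H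

    a∈A : a ∈ A
    a∈A = proj₁ (proj₂ outside-H)

    a∉H : a ∉ H
    a∉H = proj₂ (proj₂ outside-H)

    aε⁻¹∉H : a ∙ ε ⁻¹ ∉ H
    aε⁻¹∉H aε⁻¹∈ = a∉H (subst (_∈ H) (trans (cong (a ∙_) ε⁻¹≈ε) (identityʳ a)) aε⁻¹∈)

    two-images : ∣ I a ∣ + ∣ I ε ∣ ≤ m
    two-images = ≤-trans (disjoint⇒∣∪∣ (I-disjoint a∈A ε∈A aε⁻¹∉H)) (≤-trans (p⊆q⇒∣p∣≤∣q∣ inside-M⋆) T₀.∣M⋆∣≤m)
      where
      inside-M⋆ : I a ∪ I ε ⊆ M ⋆ S
      inside-M⋆ z∈ with x∈p∪q⁻ (I a) (I ε) z∈
      ... | inj₁ z∈a = I⊆M⋆ a z∈a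
      ... | inj₂ z∈ε = I⊆M⋆ ε z∈ε

    2∣M∣≤m+2∣U∣ : ∣ M ∣ + ∣ M ∣ ≤ m + (∣ U ∣ + ∣ U ∣)
    2∣M∣≤m+2∣U∣ = arith (∣ M ∣) (∣ U ∣) m (∣ T a ∣) (∣ I a ∣) (∣ T ε ∣) (∣ I ε ∣) (∣M∣≤∣U∣+∣T∣ a) (∣M∣≤∣U∣+∣T∣ ε)
      (∣T∣≤∣I∣ a∈A) (∣T∣≤∣I∣ ε∈A) two-images
      where
      arith : ∀ k u m t i t′ i′ → k ≤ u + t → k ≤ u + t′ → t ≤ i → t′ ≤ i′ → i + i′ ≤ m → k + k ≤ m + (u + u)
      arith k u m t i t′ i′ h₁ h₂ h₃ h₄ h₅ = lin 0 (h₁ ⊕ h₂ ⊕ h₃ ⊕ h₄ ⊕ h₅)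
        (solve (k ∷ u ∷ m ∷ t ∷ i ∷ t′ ∷ i′ ∷ []))

    U-nonempty : Nonempty U
    U-nonempty = 1≤∣∣⇒Nonempty U (positive ∣ U ∣ (arith (∣ M ∣) (∣ U ∣) m 2∣M∣≤m+2∣U∣ (small⇒m≤ admM M-small) 3≤∣A∣))
      where
      arith : ∀ k u m → k + k ≤ m + (u + u) → m ≤ k → 3 ≤ m → 3 ≤ u + u
      arith k u m h₁ h₂ h₃ = lin 0 (h₁ ⊕ h₂ ⊕ h₂ ⊕ h₃) (solve (k ∷ u ∷ m ∷ []))
      positive : ∀ u → 3 ≤ u + u → 1 ≤ u
      positive (suc u) _ = s≤s z≤n

    -- UA is contained in M, so M inherits the lower bound on the excess of U.
    m+2∣U∣≤2∣M∣ : m + (∣ U ∣ + ∣ U ∣) ≤ ∣ M ∣ + ∣ M ∣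
    m+2∣U∣≤2∣M∣ = ≤-trans (Generates⇒excess ε∈A generates U-nonempty U⋆) (UA≤M ⊕ UA≤M)
      where
      UA≤M : ∣ U ⊙ A ∣ ≤ ∣ M ∣
      UA≤M = p⊆q⇒∣p∣≤∣q∣ UA⊆M
      U⋆ : 1 ≤ ∣ U ⋆ A ∣
      U⋆ = arith n (∣ U ⊙ A ∣) (∣ U ⋆ A ∣) (∣ M ∣) m s (≤-reflexive (sym (∣⊙∣+∣⋆∣ U A))) UA≤M ∣M∣+m+s≤1+n 3≤∣A∣
        where
        arith : ∀ n p q k m s → n ≤ p + q → p ≤ k → k + m + s ≤ 1 + n → 3 ≤ m → 1 ≤ q
        arith n p q k m s h₁ h₂ h₃ h₄ = lin (1 + s) (h₁ ⊕ h₂ ⊕ h₃ ⊕ h₄)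
          (solve (n ∷ p ∷ q ∷ k ∷ m ∷ s ∷ []))

    -- Three cosets of H in A would give three disjoint images in a set of
    -- m elements, each of size at least m / 2.
    two-cosets : ∀ {b} → b ∈ A → b ∉ H → b ∙ a ⁻¹ ∈ H
    two-cosets {b} b∈A b∉H = decidable-stable (b ∙ a ⁻¹ ∈? H) λ ba⁻¹∉H → n≮0 (arith (∣ M ∣) (∣ U ∣) m
      (∣ T a ∣) (∣ I a ∣) (∣ T b ∣) (∣ I b ∣) (∣ T ε ∣) (∣ I ε ∣)
      (∣M∣≤∣U∣+∣T∣ a) (∣M∣≤∣U∣+∣T∣ b) (∣M∣≤∣U∣+∣T∣ ε) (∣T∣≤∣I∣ a∈A) (∣T∣≤∣I∣ b∈A) (∣T∣≤∣I∣ ε∈A)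
      (three-images ba⁻¹∉H) m+2∣U∣≤2∣M∣ (≤-trans (s≤s z≤n) 3≤∣A∣))
      where
      bε⁻¹∉H : b ∙ ε ⁻¹ ∉ H
      bε⁻¹∉H bε⁻¹∈ = b∉H (subst (_∈ H) (trans (cong (b ∙_) ε⁻¹≈ε) (identityʳ b)) bε⁻¹∈)

      three-images : b ∙ a ⁻¹ ∉ H → ∣ I b ∣ + (∣ I a ∣ + ∣ I ε ∣) ≤ m
      three-images ba⁻¹∉H = begin
        ∣ I b ∣ + (∣ I a ∣ + ∣ I ε ∣)  ≤⟨ +-monoʳ-≤ ∣ I b ∣ (disjoint⇒∣∪∣ (I-disjoint a∈A ε∈A aε⁻¹∉H)) ⟩
        ∣ I b ∣ + ∣ I a ∪ I ε ∣        ≤⟨ disjoint⇒∣∪∣ disjoint ⟩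
        ∣ I b ∪ (I a ∪ I ε) ∣          ≤⟨ p⊆q⇒∣p∣≤∣q∣ inside-M⋆ ⟩
        ∣ M ⋆ S ∣                      ≤⟨ T₀.∣M⋆∣≤m ⟩
        m                              ∎
        where
        open ≤-Reasoning
        disjoint : ∀ {z} → z ∈ I b → z ∉ I a ∪ I ε
        disjoint z∈b z∈ with x∈p∪q⁻ (I a) (I ε) z∈
        ... | inj₁ z∈a = I-disjoint b∈A a∈A ba⁻¹∉H z∈b z∈a
        ... | inj₂ z∈ε = I-disjoint b∈A ε∈A bε⁻¹∉H z∈b z∈ε

        inside-M⋆ : I b ∪ (I a ∪ I ε) ⊆ M ⋆ S
        inside-M⋆ z∈ with x∈p∪q⁻ (I b) (I a ∪ I ε) z∈
        ... | inj₁ z∈b = I⊆M⋆ b z∈b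
        ... | inj₂ z∈′ with x∈p∪q⁻ (I a) (I ε) z∈′
        ...   | inj₁ z∈a = I⊆M⋆ a z∈a
        ...   | inj₂ z∈ε = I⊆M⋆ ε z∈ε

      arith : ∀ k u m t i t′ i′ t″ i″ → k ≤ u + t → k ≤ u + t′ → k ≤ u + t″ → t ≤ i → t′ ≤ i′ → t″ ≤ i″ →
        i′ + (i + i″) ≤ m → m + (u + u) ≤ k + k → 1 ≤ m → 1 ≤ 0
      arith k u m t i t′ i′ t″ i″ h₁ h₂ h₃ h₄ h₅ h₆ h₇ h₈ h₉ =
        lin 0 (h₁ ⊕ h₁ ⊕ h₂ ⊕ h₂ ⊕ h₃ ⊕ h₃ ⊕ h₄ ⊕ h₄ ⊕ h₅ ⊕ h₅ ⊕ h₆ ⊕ h₆ ⊕ h₇ ⊕ h₇ ⊕ h₈ ⊕ h₈ ⊕ h₈ ⊕ h₉)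
          (solve (k ∷ u ∷ m ∷ t ∷ i ∷ t′ ∷ i′ ∷ t″ ∷ i″ ∷ []))

    A⊆H∪Ha : A ⊆ H ∪ H ▸ a
    A⊆H∪Ha {b} b∈ with b ∈? H
    ... | yes b∈H = x∈p∪q⁺ (inj₁ b∈H)
    ... | no  b∉H = x∈p∪q⁺ (inj₂ (subst (_∈ H ▸ a) (xy⁻¹∙y≡x b a) (∈▸⁺ (two-cosets b∈ b∉H))))

    m≤2∣H∣ : m ≤ ∣ H ∣ + ∣ H ∣
    m≤2∣H∣ = begin
      m                    ≤⟨ p⊆q⇒∣p∣≤∣q∣ A⊆H∪Ha ⟩
      ∣ H ∪ H ▸ a ∣        ≤⟨ ∣∪∣≤ H (H ▸ a) ⟩
      ∣ H ∣ + ∣ H ▸ a ∣    ≡⟨ cong (∣ H ∣ +_) (∣▸∣ H a) ⟩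
      ∣ H ∣ + ∣ H ∣        ∎
      where open ≤-Reasoning

    2∣H∣≤m : ∣ H ∣ + ∣ H ∣ ≤ m
    2∣H∣≤m = ≤-trans (2∣K∣≤∣K⊙T∣ H-subgroup ε∈A a∈A a∉H) (p⊆q⇒∣p∣≤∣q∣ H⊙A⊆A)
      where
      H⊙A⊆A : H ⊙ A ⊆ A
      H⊙A⊆A z∈ with ∈⊙⁻ z∈
      ... | k , x , k∈ , x∈ , refl = HA⊆A k∈ x∈

    ∣M∣≤∣U∣+∣H∣ : ∣ M ∣ ≤ ∣ U ∣ + ∣ H ∣
    ∣M∣≤∣U∣+∣H∣ = *-cancelˡ-≤ 2 (arith (∣ M ∣) (∣ U ∣) m (∣ H ∣) 2∣M∣≤m+2∣U∣ m≤2∣H∣)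
      where
      arith : ∀ k u m h → k + k ≤ m + (u + u) → m ≤ h + h → 2 * k ≤ 2 * (u + h)
      arith k u m h h₁ h₂ = lin 0 (h₁ ⊕ h₂) (solve (k ∷ u ∷ m ∷ h ∷ []))

    -- Minimal cuts when A consists of two cosets of its stabiliser

    private
      h : ℕ
      h = ∣ H ∣

    closed-∩ : ∀ {X Y} → Closed H X → Closed H Y → Closed H (X ∩ Y)
    closed-∩ {X} {Y} cX cY z∈ = x∈p∩q⁺ (cX (⊙-monoˡ (p∩q⊆p X Y) z∈) , cY (⊙-monoˡ (p∩q⊆q X Y) z∈))

    closed-∪ : ∀ {X Y} → Closed H X → Closed H Y → Closed H (X ∪ Y)
    closed-∪ {X} {Y} cX cY z∈ with x∈p∪q⁻ (X ⊙ H) (Y ⊙ H) (∪-⊙ z∈)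
    ... | inj₁ z∈X = x∈p∪q⁺ (inj₁ (cX z∈X))
    ... | inj₂ z∈Y = x∈p∪q⁺ (inj₂ (cY z∈Y))

    closed-∁ : ∀ {X} → Closed H X → Closed H (∁ X)
    closed-∁ {X} cX z∈ with ∈⊙⁻ z∈
    ... | x , k , x∈ , k∈ , refl = x∉p⇒x∈∁p λ xk∈ →
      x∈∁p⇒x∉p x∈ (subst (_∈ X) (xy∙y⁻¹≡x x k) (cX (∈⊙⁺ xk∈ (H⁻¹ k∈))))

    closed-◂ : ∀ {g X} → Closed H X → Closed H (g ◂ X)
    closed-◂ cX z∈ = ∈◂⁺′ (cX (∈◂⁻ (◂-⊙⊆ z∈)))

    closed-U : Closed H U
    closed-U z∈ with ∈⊙⁻ z∈
    ... | g , k , g∈ , k∈ , refl = ∈U⁺ λ {z} z∈′ → ∈U⁻ g∈ (∈◂⁺′ (subst (_∈ A)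
      (trans (cong (λ w → k ∙ (w ∙ z)) (⁻¹-anti-homo-∙ g k)) (trans (cong (k ∙_) (assoc (k ⁻¹) (g ⁻¹) z))
        (x∙x⁻¹y≡y k (g ⁻¹ ∙ z))))
      (HA⊆A k∈ (∈◂⁻ z∈′))))

    h≤∣closed∣ : ∀ {X} → Closed H X → Nonempty X → h ≤ ∣ X ∣
    h≤∣closed∣ {X} cX (x , x∈) = subst (_≤ ∣ X ∣) (∣◂∣ x H) (p⊆q⇒∣p∣≤∣q∣ λ {z} z∈ →
      subst (_∈ X) (x∙x⁻¹y≡y x z) (cX (∈⊙⁺ x∈ (∈◂⁻ z∈))))

    -- A nonempty proper union of left cosets of H has excess at least h.
    closed⇒excess≥h : ∀ {X} → Closed H X → Nonempty X → Nonempty (∁ X) → ∣ X ∣ + h ≤ ∣ X ⊙ A ∣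
    closed⇒excess≥h {X} cX ne ne∁ with 1 ≤? ∣ X ⋆ A ∣
    ... | yes 1≤X⋆ = *-cancelˡ-≤ 2 (arith (∣ X ∣) (∣ X ⊙ A ∣) m h (Generates⇒excess ε∈A generates ne 1≤X⋆) 2∣H∣≤m)
      where
      arith : ∀ x xa m h → m + (x + x) ≤ xa + xa → h + h ≤ m → 2 * (x + h) ≤ 2 * xa
      arith x xa m h h₁ h₂ = lin 0 (h₁ ⊕ h₂) (solve (x ∷ xa ∷ m ∷ h ∷ []))
    ... | no  1≰X⋆ = arith (∣ X ∣) (∣ ∁ X ∣) (∣ X ⊙ A ∣) (∣ X ⋆ A ∣) h (≤-pred (≰⇒> 1≰X⋆)) (h≤∣closed∣ (closed-∁ cX) ne∁)
        (≤-reflexive (trans (∣p∣+∣∁p∣ X) (sym (∣⊙∣+∣⋆∣ X A))))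
      where
      arith : ∀ x x′ p q h → q ≤ 0 → h ≤ x′ → x + x′ ≤ p + q → x + h ≤ p
      arith x x′ p q h h₁ h₂ h₃ = lin 0 (h₁ ⊕ h₂ ⊕ h₃) (solve (x ∷ x′ ∷ p ∷ q ∷ h ∷ []))

    -- For unions of left cosets of H the excess is the size of Xa − X, which equals
    -- the excess of the complement because |Xa| = |X|.
    excess-∁ : ∀ {X} → Closed H X → ∣ X ⊙ A ∣ ≤ ∣ X ∣ + h → ∣ ∁ X ⊙ A ∣ ≤ ∣ ∁ X ∣ + h
    excess-∁ {X} cX X≤ = arith (∣ X ∣) (∣ ∁ X ∣) (∣ X ⊙ A ∣) (∣ ∁ X ⊙ A ∣) (∣ X ∪ X ▸ a ∣) (∣ X ∩ X ▸ a ∣) (∣ ∁ (X ∩ X ▸ a) ∣) h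
      X≤ (p⊆q⇒∣p∣≤∣q∣ ∪⊆XA) (p⊆q⇒∣p∣≤∣q∣ ∁XA⊆)
      (≤-reflexive (sym (trans (∣p∪q∣+∣p∩q∣ X (X ▸ a)) (cong (∣ X ∣ +_) (∣▸∣ X a)))))
      (≤-reflexive (trans (∣p∣+∣∁p∣ (X ∩ X ▸ a)) (sym (∣p∣+∣∁p∣ X))))
      where
      ∪⊆XA : X ∪ X ▸ a ⊆ X ⊙ A
      ∪⊆XA {z} z∈ with x∈p∪q⁻ X (X ▸ a) z∈
      ... | inj₁ z∈X  = X⊆X⊙A ε∈A z∈X
      ... | inj₂ z∈Xa = subst (_∈ X ⊙ A) (xy⁻¹∙y≡x z a) (∈⊙⁺ (∈▸⁻ z∈Xa) a∈A)

      ∁XA⊆ : ∁ X ⊙ A ⊆ ∁ (X ∩ X ▸ a)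
      ∁XA⊆ z∈ with ∈⊙⁻ z∈
      ... | y , b , y∈ , b∈ , refl with x∈p∪q⁻ H (H ▸ a) (A⊆H∪Ha b∈)
      ...   | inj₁ b∈H  = x∉p⇒x∈∁p λ yb∈ →
        x∈∁p⇒x∉p (closed-∁ cX (∈⊙⁺ y∈ b∈H)) (p∩q⊆p X (X ▸ a) yb∈)
      ...   | inj₂ b∈Ha = x∉p⇒x∈∁p λ yb∈ →
        x∈∁p⇒x∉p (closed-∁ cX (∈⊙⁺ y∈ (∈▸⁻ b∈Ha)))
          (subst (_∈ X) (assoc y b (a ⁻¹)) (∈▸⁻ (p∩q⊆q X (X ▸ a) yb∈)))

      arith : ∀ x x′ xa x′a u p p′ h → xa ≤ x + h → u ≤ xa → x′a ≤ p′ → x + x ≤ u + p → p + p′ ≤ x + x′ →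
        x′a ≤ x′ + h
      arith x x′ xa x′a u p p′ h h₁ h₂ h₃ h₄ h₅ = lin 0 (h₁ ⊕ h₂ ⊕ h₃ ⊕ h₄ ⊕ h₅)
        (solve (x ∷ x′ ∷ xa ∷ x′a ∷ u ∷ p ∷ p′ ∷ h ∷ []))

    -- A union of left cosets of H of excess at most h such that it and its
    -- complement contain more than one coset.
    Cut : Subset n → Set
    Cut X = Closed H X × h < ∣ X ∣ × h < ∣ ∁ X ∣ × ∣ X ⊙ A ∣ ≤ ∣ X ∣ + h

    ∣∁◂∣ : ∀ g X → ∣ ∁ (g ◂ X) ∣ ≡ ∣ ∁ X ∣
    ∣∁◂∣ g X = +-cancelˡ-≡ (∣ X ∣) (∣ ∁ (g ◂ X) ∣) (∣ ∁ X ∣) (trans (cong (_+ ∣ ∁ (g ◂ X) ∣) (sym (∣◂∣ g X)))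
      (trans (∣p∣+∣∁p∣ (g ◂ X)) (sym (∣p∣+∣∁p∣ X))))

    Cut-◂ : ∀ {X} g → Cut X → Cut (g ◂ X)
    Cut-◂ {X} g (cX , h<X , h<∁X , X≤) = closed-◂ cX , subst (h <_) (sym (∣◂∣ g X)) h<X ,
      subst (h <_) (sym (∣∁◂∣ g X)) h<∁X , subst₂ (λ p q → q ≤ p + h) (sym (∣◂∣ g X)) (sym (∣◂⊙∣ g X A)) X≤

    Cut-∁ : ∀ {X} → Cut X → Cut (∁ X)
    Cut-∁ {X} (cX , h<X , h<∁X , X≤) = closed-∁ cX , h<∁X ,
      subst (h <_) (+-cancelˡ-≡ (∣ ∁ X ∣) (∣ X ∣) (∣ ∁ (∁ X) ∣)
        (trans (+-comm (∣ ∁ X ∣) (∣ X ∣)) (trans (∣p∣+∣∁p∣ X) (sym (∣p∣+∣∁p∣ (∁ X)))))) h<X ,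
      excess-∁ cX X≤

    opaque
      smallest-cut : ∀ {X} → Cut X → ∃ λ W → ε ∈ W × Cut W × (∀ {Y} → Cut Y → ∣ W ∣ ≤ ∣ Y ∣)
      smallest-cut {X} cutX with argmin subsets-searchable (λ Y → (Y ⊙ H ⊆? Y) ×-dec (h <? ∣ Y ∣) ×-dec
        (h <? ∣ ∁ Y ∣) ×-dec (∣ Y ⊙ A ∣ ≤? ∣ Y ∣ + h)) ∣_∣ (X , (λ {_} → proj₁ cutX) , proj₂ cutX)
      ... | W , cutW , least with 1≤∣∣⇒Nonempty W (≤-trans (s≤s z≤n) (proj₁ (proj₂ cutW)))
      ...   | x , x∈ = x ⁻¹ ◂ W , ε∈x⁻¹◂ x∈ , Cut-◂ (x ⁻¹) ((λ {_} → proj₁ cutW) , proj₂ cutW) ,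
              λ {Y} cutY → subst (_≤ ∣ Y ∣) (sym (∣◂∣ (x ⁻¹) W)) (least Y ((λ {_} → proj₁ cutY) , proj₂ cutY))

    -- No smallest cut W exists.  Uncrossing W with its translates and with
    -- their complements shows that W is a subgroup, which contradicts that
    -- A generates, or consists of two cosets of H, which has too large an
    -- excess.
    module SmallestCut {W : Subset n} (ε∈W : ε ∈ W) (cutW : Cut W) (least : ∀ {Y} → Cut Y → ∣ W ∣ ≤ ∣ Y ∣) where

      closed-W : Closed H W
      closed-W = proj₁ cutW

      h<∣W∣ : h < ∣ W ∣
      h<∣W∣ = proj₁ (proj₂ cutW)

      W-excess : ∣ W ⊙ A ∣ ≤ ∣ W ∣ + h
      W-excess = proj₂ (proj₂ (proj₂ cutW))

      H⊆W : H ⊆ W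
      H⊆W {k} k∈ = closed-W (subst (_∈ W ⊙ H) (identityˡ k) (∈⊙⁺ ε∈W k∈))

      -- Let V have excess at most h.  A cut cannot be smaller than W, so by
      -- submodularity W ∩ V has at most h elements unless W ∩ V = W or W ∪ V is
      -- everything.
      uncross : ∀ {V} → Closed H V → ∣ V ⊙ A ∣ ≤ ∣ V ∣ + h → ∣ W ∩ V ∣ < ∣ W ∣ → Nonempty (∁ (W ∪ V)) →
        ∣ W ∩ V ∣ ≤ h
      uncross {V} cV V-excess P<W ∪≠⊤ = ≮⇒≥ λ h<P → <⇒≱ (P-excess h<P)
        (arith (∣ W ∣) (∣ W ⊙ A ∣) (∣ V ∣) (∣ V ⊙ A ∣) (∣ W ∩ V ∣) (∣ (W ∩ V) ⊙ A ∣) (∣ W ∪ V ∣) (∣ (W ∪ V) ⊙ A ∣) h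
          (submodular W V A) W-excess V-excess
          (closed⇒excess≥h (closed-∪ closed-W cV) (ε , x∈p∪q⁺ (inj₁ ε∈W)) ∪≠⊤)
          (≤-reflexive (sym (∣p∪q∣+∣p∩q∣ W V))))
        where
        P-excess : h < ∣ W ∩ V ∣ → ∣ W ∩ V ∣ + h < ∣ (W ∩ V) ⊙ A ∣
        P-excess h<P = ≰⇒> λ PA≤ → <⇒≱ P<W (least (closed-∩ closed-W cV , h<P ,
          ≤-trans (proj₁ (proj₂ (proj₂ cutW))) (p⊆q⇒∣p∣≤∣q∣ (p⊆q⇒∁p⊇∁q (p∩q⊆p W V))) , PA≤))

        arith : ∀ w wa v va p pa u ua h → ua + pa ≤ wa + va → wa ≤ w + h → va ≤ v + h → u + h ≤ ua →
          w + v ≤ u + p → pa ≤ p + h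
        arith w wa v va p pa u ua h h₁ h₂ h₃ h₄ h₅ = lin 0 (h₁ ⊕ h₂ ⊕ h₃ ⊕ h₄ ⊕ h₅)
          (solve (w ∷ wa ∷ v ∷ va ∷ p ∷ pa ∷ u ∷ ua ∷ h ∷ []))

      not-subgroup : ¬ Subgroup W
      not-subgroup W-subgroup with 1≤∣∣⇒Nonempty (∁ W) (≤-trans (s≤s z≤n) (proj₁ (proj₂ (proj₂ cutW))))
      ... | z , z∈ = x∈∁p⇒x∉p z∈ (generates (ε , ε∈W) closed z)
        where
        open Subgroup W-subgroup

        a∈W : a ∈ W
        a∈W = decidable-stable (a ∈? W) λ a∉ → <⇒≱ h<∣W∣
          (arith (∣ W ∣) (∣ W ⊙ A ∣) h W-excess (2∣K∣≤∣K⊙T∣ W-subgroup ε∈A a∈A a∉))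
          where
          arith : ∀ w wa h → wa ≤ w + h → w + w ≤ wa → w ≤ h
          arith w wa h h₁ h₂ = lin 0 (h₁ ⊕ h₂) (solve (w ∷ wa ∷ h ∷ []))

        closed : Closed A W
        closed x∈ with ∈⊙⁻ x∈
        ... | w , b , w∈ , b∈ , refl with x∈p∪q⁻ H (H ▸ a) (A⊆H∪Ha b∈)
        ...   | inj₁ b∈H  = ∙∈ w∈ (H⊆W b∈H)
        ...   | inj₂ b∈Ha = ∙∈ w∈ (subst (_∈ W) (xy⁻¹∙y≡x b a) (∙∈ (H⊆W (∈▸⁻ b∈Ha)) a∈W))

      module _ (g : Fin n) (meets : Nonempty (W ∩ g ◂ W)) (crosses : ¬ W ⊆ g ◂ W) where

        ∣W∩gW∣≤h : ∣ W ∩ g ◂ W ∣ ≤ h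
        ∣W∩gW∣≤h = uncross (closed-◂ closed-W)
          (subst₂ (λ p q → q ≤ p + h) (sym (∣◂∣ g W)) (sym (∣◂⊙∣ g W A)) W-excess)
          (≰⇒> λ W≤P → crosses λ x∈ → p∩q⊆q W (g ◂ W) (⊆∧∣∣≥⇒⊇ (p∩q⊆p W (g ◂ W)) W≤P x∈))
          (1≤∣∣⇒Nonempty (∁ (W ∪ g ◂ W)) (arith (∣ W ∣) (∣ ∁ W ∣) (∣ W ∪ g ◂ W ∣) (∣ W ∩ g ◂ W ∣) (∣ ∁ (W ∪ g ◂ W) ∣)
            (least (Cut-∁ cutW))
            (≤-reflexive (trans (∣p∪q∣+∣p∩q∣ W (g ◂ W)) (cong (∣ W ∣ +_) (∣◂∣ g W))))
            (≤-reflexive (trans (∣p∣+∣∁p∣ W) (sym (∣p∣+∣∁p∣ (W ∪ g ◂ W)))))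
            (∈⇒1≤∣∣ (proj₂ meets))))
          where
          arith : ∀ w w′ u p u′ → w ≤ w′ → u + p ≤ w + w → w + w′ ≤ u + u′ → 1 ≤ p → 1 ≤ u′
          arith w w′ u p u′ h₁ h₂ h₃ h₄ = lin 0 (h₁ ⊕ h₂ ⊕ h₃ ⊕ h₄) (solve (w ∷ w′ ∷ u ∷ p ∷ u′ ∷ []))

        ∣W∖gW∣≤h : ∣ W ∩ ∁ (g ◂ W) ∣ ≤ h
        ∣W∖gW∣≤h = uncross (closed-∁ (closed-◂ closed-W))
          (excess-∁ (closed-◂ closed-W)
            (subst₂ (λ p q → q ≤ p + h) (sym (∣◂∣ g W)) (sym (∣◂⊙∣ g W A)) W-excess))
          (p⊂q⇒∣p∣<∣q∣ (p∩q⊆p W (∁ (g ◂ W)) , proj₁ meets , p∩q⊆p W (g ◂ W) (proj₂ meets) , λ x∈ →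
            x∈∁p⇒x∉p (p∩q⊆q W (∁ (g ◂ W)) x∈) (p∩q⊆q W (g ◂ W) (proj₂ meets))))
          escapes
          where
          escapes : Nonempty (∁ (W ∪ ∁ (g ◂ W)))
          escapes with any? (λ x → (x ∈? g ◂ W) ×-dec ¬? (x ∈? W))
          ... | yes (x , x∈gW , x∉W) = x , x∉p⇒x∈∁p λ x∈ → case x∈p∪q⁻ W (∁ (g ◂ W)) x∈ of λ where
                  (inj₁ x∈W) → x∉W x∈W
                  (inj₂ x∉gW) → x∈∁p⇒x∉p x∉gW x∈gW
          ... | no  none = contradiction (λ {x} x∈ → ⊆∧∣∣≥⇒⊇ {p = g ◂ W} {q = W}
                  (λ {y} y∈ → decidable-stable (y ∈? W) λ y∉ → none (y , y∈ , y∉))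
                  (≤-reflexive (sym (∣◂∣ g W))) {x} x∈) crosses

        -- W has at most 2h elements but meets two cosets of H, and the
        -- corresponding two lines share at most one element.
        crossing⇒⊥ : ¬ (3 ≤ m)
        crossing⇒⊥ 3≤m with ∣∣<⇒∃∉ W H h<∣W∣
        ... | y , y∈W , y∉H = n≮0 (arith (∣ W ∣) (∣ W ⊙ A ∣) (∣ W ∩ g ◂ W ∣) (∣ W ∩ ∁ (g ◂ W) ∣) m h
              (∣ A ∪ y ◂ A ∣) (∣ A ∩ y ◂ A ∣)
              split ∣W∩gW∣≤h ∣W∖gW∣≤h W-excess (p⊆q⇒∣p∣≤∣q∣ two-lines) ∣A∩yA∣≤1
              (≤-reflexive (sym (trans (∣p∪q∣+∣p∩q∣ A (y ◂ A)) (cong (m +_) (∣◂∣ y A))))) 2∣H∣≤m 3≤m)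
          where
          split : ∣ W ∣ ≤ ∣ W ∩ g ◂ W ∣ + ∣ W ∩ ∁ (g ◂ W) ∣
          split = ≤-trans (p⊆q⇒∣p∣≤∣q∣ {p = W} {q = W ∩ g ◂ W ∪ W ∩ ∁ (g ◂ W)} λ {x} x∈ → case x ∈? g ◂ W of λ where
              (yes x∈gW) → x∈p∪q⁺ (inj₁ (x∈p∩q⁺ (x∈ , x∈gW)))
              (no  x∉gW) → x∈p∪q⁺ (inj₂ (x∈p∩q⁺ (x∈ , x∉p⇒x∈∁p x∉gW))))
            (∣∪∣≤ (W ∩ g ◂ W) (W ∩ ∁ (g ◂ W)))

          two-lines : A ∪ y ◂ A ⊆ W ⊙ A
          two-lines {x} x∈ with x∈p∪q⁻ A (y ◂ A) x∈
          ... | inj₁ x∈A  = subst (_∈ W ⊙ A) (identityˡ x) (∈⊙⁺ ε∈W x∈A)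
          ... | inj₂ x∈yA = subst (_∈ W ⊙ A) (x∙x⁻¹y≡y y x) (∈⊙⁺ y∈W (∈◂⁻ x∈yA))

          ∣A∩yA∣≤1 : ∣ A ∩ y ◂ A ∣ ≤ 1
          ∣A∩yA∣≤1 = ≮⇒≥ λ 2≤ → y∉H (∈H⁺ (atoms-meet⇒⊆ atom (atom-◂ y atom) 2≤))

          arith : ∀ w wa p q m h u i → w ≤ p + q → p ≤ h → q ≤ h → wa ≤ w + h → u ≤ wa → i ≤ 1 →
            m + m ≤ u + i → h + h ≤ m → 3 ≤ m → 1 ≤ 0
          arith w wa p q m h u i h₁ h₂ h₃ h₄ h₅ h₆ h₇ h₈ h₉ =
            lin 0 (h₁ ⊕ h₁ ⊕ h₂ ⊕ h₂ ⊕ h₃ ⊕ h₃ ⊕ h₄ ⊕ h₄ ⊕ h₅ ⊕ h₅ ⊕ h₆ ⊕ h₆ ⊕ h₇ ⊕ h₇ ⊕ h₈ ⊕ h₈ ⊕ h₈ ⊕ h₉)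
              (solve (w ∷ wa ∷ p ∷ q ∷ m ∷ h ∷ u ∷ i ∷ []))

      no-smallest-cut : ¬ (3 ≤ m)
      no-smallest-cut 3≤m with any? (λ g → nonempty? (W ∩ g ◂ W) ×-dec ¬? (W ⊆? g ◂ W))
      ... | yes (g , meets , crosses) = crossing⇒⊥ g meets crosses 3≤m
      ... | no  none = not-subgroup (block⇒Subgroup ε∈W λ g meets → decidable-stable (W ⊆? g ◂ W) λ crosses →
              none (g , meets , crosses))

    no-cut : ∀ {X} → ¬ Cut X
    no-cut cutX with smallest-cut cutX
    ... | W , ε∈W , cutW , least = SmallestCut.no-smallest-cut ε∈W cutW least 3≤∣A∣

    -- The double coset HaH has |H|² elements, since H and its conjugate by a
    -- lie in two distinct lines through ε.
    ∣H∣²≤n : h * h ≤ n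
    ∣H∣²≤n = injective⇒≤ {f = λ i → f (remQuot h i)} λ {i} {j} eq → let (p≡ , q≡) = f-injective _ _ eq in
      trans (sym (combine-remQuot {h} h i)) (trans (cong₂ combine p≡ q≡) (combine-remQuot {h} h j))
      where
      f : Fin h × Fin h → Fin n
      f (p , q) = enum H p ∙ (a ∙ enum H q)

      conjugate : ∀ {w k} → w ∈ H → k ∈ H → a ∙ w ≡ k ∙ a → w ≡ ε
      conjugate {w} {k} w∈ k∈ aw≡ka = decidable-stable (w ≟ᶠ ε) λ w≢ε → a∉H (subst (_∈ H) (⁻¹-involutive a)
        (H⁻¹ (∈H⁺ (atoms-meet⇒⊆ atom (atom-◂ (a ⁻¹) atom) (≢⇒2≤∣∣
          (x∈p∩q⁺ (H⊆A w∈ , ∈◂⁺′ (subst (_∈ A) (sym (trans (cong (_∙ w) (⁻¹-involutive a)) aw≡ka)) (HA⊆A k∈ a∈A))))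
          (x∈p∩q⁺ (ε∈A , ε∈x⁻¹◂ a∈A)) w≢ε)))))

      f-injective : ∀ i j → f i ≡ f j → proj₁ i ≡ proj₁ j × proj₂ i ≡ proj₂ j
      f-injective (p , q) (p′ , q′) eq = enum-injective H x≡x′ , enum-injective H y≡y′
        where
        x  = enum H p
        x′ = enum H p′
        y  = enum H q
        y′ = enum H q′

        ayy′⁻¹ : a ∙ (y ∙ y′ ⁻¹) ≡ (x ⁻¹ ∙ x′) ∙ a
        ayy′⁻¹ = begin
          a ∙ (y ∙ y′ ⁻¹)                     ≡⟨ assoc a y (y′ ⁻¹) ⟨
          (a ∙ y) ∙ y′ ⁻¹                     ≡⟨ cong (_∙ y′ ⁻¹) (x⁻¹∙xy≡y x (a ∙ y)) ⟨
          (x ⁻¹ ∙ (x ∙ (a ∙ y))) ∙ y′ ⁻¹      ≡⟨ cong (λ w → (x ⁻¹ ∙ w) ∙ y′ ⁻¹) eq ⟩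
          (x ⁻¹ ∙ (x′ ∙ (a ∙ y′))) ∙ y′ ⁻¹    ≡⟨ cong (_∙ y′ ⁻¹) (assoc (x ⁻¹) x′ (a ∙ y′)) ⟨
          ((x ⁻¹ ∙ x′) ∙ (a ∙ y′)) ∙ y′ ⁻¹    ≡⟨ cong (_∙ y′ ⁻¹) (assoc (x ⁻¹ ∙ x′) a y′) ⟨
          (((x ⁻¹ ∙ x′) ∙ a) ∙ y′) ∙ y′ ⁻¹    ≡⟨ xy∙y⁻¹≡x ((x ⁻¹ ∙ x′) ∙ a) y′ ⟩
          (x ⁻¹ ∙ x′) ∙ a                     ∎
          where open ≡-Reasoning

        y≡y′ : y ≡ y′
        y≡y′ = trans (sym (xy⁻¹∙y≡x y y′)) (trans (cong (_∙ y′) (conjugate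
          (H∙ (enum∈ H q) (H⁻¹ (enum∈ H q′))) (H∙ (H⁻¹ (enum∈ H p)) (enum∈ H p′)) ayy′⁻¹)) (identityˡ y′))

        x≡x′ : x ≡ x′
        x≡x′ = ∙-cancelʳ (a ∙ y) x x′ (trans eq (cong (λ w → x′ ∙ (a ∙ w)) (sym y≡y′)))

    -- The hypothesis on |S| gives n - |S| ≥ 4|H|.  As |M| = n - |S| - m + 1 and
    -- |U| ≥ |M| - |H|, the set U contains more than one coset of H, so it is a
    -- cut.
    far-from-full⇒⊥ : s ≤ n → ¬ (16 * n ≤ (n ∸ s) ^ 2)
    far-from-full⇒⊥ s≤n 16n≤ = no-cut (closed-U , h<∣U∣ , h<∣∁U∣ , ≤-trans (p⊆q⇒∣p∣≤∣q∣ UA⊆M) ∣M∣≤∣U∣+∣H∣)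
      where
      d : ℕ
      d = n ∸ s

      1≤h : 1 ≤ h
      1≤h = ∈⇒1≤∣∣ ε∈H

      4h≤d : 4 * h ≤ d
      4h≤d = ≮⇒≥ λ d<4h → <⇒≱ (begin-strict
        d ^ 2              ≡⟨ cong (d *_) (*-identityʳ d) ⟩
        d * d              <⟨ *-mono-< d<4h d<4h ⟩
        (4 * h) * (4 * h)  ≡⟨ square h ⟩
        16 * (h * h)       ≤⟨ *-monoʳ-≤ 16 ∣H∣²≤n ⟩
        16 * n             ∎) 16n≤
        where
        open ≤-Reasoning
        square : ∀ k → (4 * k) * (4 * k) ≡ 16 * (k * k)
        square k = solve (k ∷ [])

      h<∣U∣ : h < ∣ U ∣
      h<∣U∣ = arith n d s (∣ M ∣) (∣ U ∣) m h 4h≤d (≤-reflexive (m∸n+n≡m s≤n)) n<∣M∣+m+s m≤2∣H∣ ∣M∣≤∣U∣+∣H∣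
        where
        arith : ∀ n d s k u m h → 4 * h ≤ d → d + s ≤ n → 1 + n ≤ k + m + s → m ≤ h + h → k ≤ u + h → 1 + h ≤ u
        arith n d s k u m h h₁ h₂ h₃ h₄ h₅ = lin 0 (h₁ ⊕ h₂ ⊕ h₃ ⊕ h₄ ⊕ h₅) (solve (n ∷ d ∷ s ∷ k ∷ u ∷ m ∷ h ∷ []))

      h<∣∁U∣ : h < ∣ ∁ U ∣
      h<∣∁U∣ = arith n s (∣ M ∣) (∣ U ∣) (∣ ∁ U ∣) m h ∣M∣+m+s≤1+n (p⊆q⇒∣p∣≤∣q∣ U⊆M)
        (≤-reflexive (sym (∣p∣+∣∁p∣ U))) 2∣H∣≤m 1≤h (∈⇒1≤∣∣ (proj₂ S-nonempty))
        where
        U⊆M : U ⊆ M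
        U⊆M {g} g∈ = ∈U⁻ g∈ (subst (_∈ g ◂ A) (identityʳ g) (∈◂⁺ ε∈A))
        arith : ∀ n s k u u′ m h → k + m + s ≤ 1 + n → u ≤ k → n ≤ u + u′ → h + h ≤ m → 1 ≤ h → 1 ≤ s → 1 + h ≤ u′
        arith n s k u u′ m h h₁ h₂ h₃ h₄ h₅ h₆ = lin 0 (h₁ ⊕ h₂ ⊕ h₃ ⊕ h₄ ⊕ h₅ ⊕ h₆)
          (solve (n ∷ s ∷ k ∷ u ∷ u′ ∷ m ∷ h ∷ []))

  -- The structure of S

  small-set⇒Progression : ∀ {S} → ∣ S ∣ ≤ 1 → Progression S
  small-set⇒Progression {S} S≤1 with nonempty? S
  ... | yes (y , y∈) = ε , y ,
        (λ x∈ → 0 , ∈⇒1≤∣∣ x∈ , trans (∣∣≤1⇒≡ S≤1 x∈ y∈) (sym (identityˡ y))) ,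
        λ i i<s → subst (λ j → pow ε j ∙ y ∈ S) (sym (n<1⇒n≡0 (<-≤-trans i<s S≤1)))
          (subst (_∈ S) (sym (identityˡ y)) y∈)
  ... | no  empty = ε , ε , (λ x∈ → contradiction (_ , x∈) empty) ,
        λ i i<s → contradiction (1≤∣∣⇒Nonempty S (≤-trans (s≤s z≤n) i<s)) empty

  -- A proper subgroup K with more than one element and |KS| ≤ |K| + |S| - 1.
  SmallSubgroup : Subset n → Set
  SmallSubgroup S = ∃ λ K → Subgroup K × 2 ≤ ∣ K ∣ × Nonempty (∁ K) × Small S K

  ∣S∣≤∣X⊙S∣ : ∀ {X S} → Nonempty X → ∣ S ∣ ≤ ∣ X ⊙ S ∣
  ∣S∣≤∣X⊙S∣ {X} {S} (x , x∈) = subst (_≤ ∣ X ⊙ S ∣) (∣◂∣ x S) (p⊆q⇒∣p∣≤∣q∣ λ {z} z∈ →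
    subst (_∈ X ⊙ S) (x∙x⁻¹y≡y x z) (∈⊙⁺ x∈ (∈◂⁻ z∈)))

  ∣X∣≤∣X⊙S∣ : ∀ {X S} → Nonempty S → ∣ X ∣ ≤ ∣ X ⊙ S ∣
  ∣X∣≤∣X⊙S∣ {X} {S} (s , s∈) = subst (_≤ ∣ X ⊙ S ∣) (∣▸∣ X s) (p⊆q⇒∣p∣≤∣q∣ λ {z} z∈ →
    subst (_∈ X ⊙ S) (xy⁻¹∙y≡x z s) (∈⊙⁺ (∈▸⁻ z∈) s∈))

  ∣singleton⊙∣ : ∀ x S → ∣ ⁅ x ⁆ ⊙ S ∣ ≤ ∣ S ∣
  ∣singleton⊙∣ x S = subst (∣ ⁅ x ⁆ ⊙ S ∣ ≤_) (∣◂∣ x S) (p⊆q⇒∣p∣≤∣q∣ inside-xS)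
    where
    inside-xS : ⁅ x ⁆ ⊙ S ⊆ x ◂ S
    inside-xS z∈ with ∈⊙⁻ z∈
    ... | y , s , y∈ , s∈ , refl = subst (λ w → w ∙ s ∈ x ◂ S) (sym (x∈⁅y⁆⇒x≡y x y∈)) (∈◂⁺ s∈)

  -- The conclusion for S once singletons have least excess and the 2-atom
  -- for S is small.
  small-atom⇒structure : ∀ {S A} → CauchyDavenport S → IsAtom 2 S A → Small S A → Nonempty S → ∣ S ∣ ≤ n →
    16 * n ≤ (n ∸ ∣ S ∣) ^ 2 → Progression S ⊎ SmallSubgroup S
  small-atom⇒structure {S} {A₀} cd atom₀ small₀ S-nonempty s≤n 16n≤ =
    by-generation (generated A)
    where
    x : ∃ λ x → x ∈ A₀
    x = 1≤∣∣⇒Nonempty A₀ (≤-trans (s≤s z≤n) (proj₁ (IsAtom.adm atom₀)))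

    A : Subset n
    A = proj₁ x ⁻¹ ◂ A₀

    ε∈A : ε ∈ A
    ε∈A = ε∈x⁻¹◂ (proj₂ x)

    atom : IsAtom 2 S A
    atom = atom-◂ (proj₁ x ⁻¹) atom₀

    A-small : Small S A
    A-small = subst₂ (λ a b → suc b ≤ a + ∣ S ∣) (sym (∣◂∣ _ A₀)) (sym (∣◂⊙∣ _ A₀ S)) small₀

    1≤∣A⋆S∣ : 1 ≤ ∣ A ⋆ S ∣
    1≤∣A⋆S∣ = ≤-trans (s≤s z≤n) (proj₂ (IsAtom.adm atom))

    by-size : Generates A → Progression S
    by-size generates with 3 ≤? ∣ A ∣
    ... | yes 3≤A = contradiction 16n≤
          (LargeAtom.far-from-full⇒⊥ cd atom ε∈A A-small generates S-nonempty 3≤A s≤n)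
    ... | no  3≰A = two-element⇒Progression ε∈A (≤-antisym (≤-pred (≰⇒> 3≰A)) (proj₁ (IsAtom.adm atom)))
          generates A-small 1≤∣A⋆S∣ S-nonempty

    by-generation : (∃ λ K → Subgroup K × Closed A K × (∀ X → Nonempty X → Closed A X → ∣ K ∣ ≤ ∣ X ∣)) →
      Progression S ⊎ SmallSubgroup S
    by-generation (K , K-subgroup , K-closed , K-least) with nonempty? (∁ K)
    ... | yes proper = inj₂ (K , K-subgroup , ≤-trans (proj₁ (IsAtom.adm atom)) (p⊆q⇒∣p∣≤∣q∣ A⊆K) , proper ,
            generated-small cd ε∈A A-small 1≤∣A⋆S∣ K-subgroup (λ {_} → K-closed) K-least)
      where
      A⊆K : A ⊆ K
      A⊆K {a} a∈ = K-closed (subst (_∈ K ⊙ A) (identityˡ a) (∈⊙⁺ (Subgroup.ε∈ K-subgroup) a∈))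
    ... | no  full = inj₁ (by-size λ {X} ne closed y → ⊆∧∣∣≥⇒⊇ {p = X} (λ _ → ∈⊤)
            (≤-trans (p⊆q⇒∣p∣≤∣q∣ {p = ⊤} λ {z} _ → decidable-stable (z ∈? K) λ z∉ → full (z , x∉p⇒x∈∁p z∉))
              (K-least X ne closed)) ∈⊤)

  -- A small set T of size at least 2, whose product with S omits at least
  -- two elements, determines the structure of S or of its set of inverses.
  small-product⇒structure : ∀ {S T} → Nonempty S → Adm 2 S T → Small S T → ∣ S ∣ ≤ n → 16 * n ≤ (n ∸ ∣ S ∣) ^ 2 →
    (Progression S ⊎ Progression (inv S)) ⊎ (SmallSubgroup S ⊎ SmallSubgroup (inv S))
  small-product⇒structure {S} {T} S-nonempty admT T-small s≤n 16n≤ = by-1-atom (proj₂ (atom-exists adm₁T))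
    where
    Structure : Set
    Structure = (Progression S ⊎ Progression (inv S)) ⊎ (SmallSubgroup S ⊎ SmallSubgroup (inv S))

    inv-nonempty : Nonempty (inv S)
    inv-nonempty = proj₁ S-nonempty ⁻¹ , ∈inv⁺ (proj₂ S-nonempty)

    adm₁T : Adm 1 S T
    adm₁T = ≤-trans (s≤s z≤n) (proj₁ admT) , ≤-trans (s≤s z≤n) (proj₂ admT)

    from-least⁻ : ∀ {k F Y} → IsAtom k (inv S) F → Adm k S Y → ∣ F ⊙ inv S ∣ + ∣ Y ∣ ≤ ∣ Y ⊙ S ∣ + ∣ F ∣
    from-least⁻ {k} {F} {Y} atom = subst (λ R → Adm k R Y → ∣ F ⊙ inv S ∣ + ∣ Y ∣ ≤ ∣ Y ⊙ R ∣ + ∣ F ∣)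
      (inv-involutive S) (IsAtom.least⁻ atom)

    t : Fin n
    t = proj₁ (1≤∣∣⇒Nonempty T (proj₁ adm₁T))

    adm-t : Adm 1 S ⁅ t ⁆
    adm-t = ≤-reflexive (sym (∣⁅x⁆∣≡1 t)) , ≤-trans (proj₂ adm₁T) (p⊆q⇒∣p∣≤∣q∣ (⋆-antitone λ {z} z∈ →
      subst (_∈ T) (sym (x∈⁅y⁆⇒x≡y t z∈)) (proj₂ (1≤∣∣⇒Nonempty T (proj₁ adm₁T)))))

    -- Comparison with a singleton.
    1-atom-small : ∀ {p k} → p + ∣ ⁅ t ⁆ ∣ ≤ ∣ ⁅ t ⁆ ⊙ S ∣ + k → suc p ≤ k + ∣ S ∣
    1-atom-small {p} {k} h = arith p k (∣ S ∣) (∣ ⁅ t ⁆ ∣) (∣ ⁅ t ⁆ ⊙ S ∣) h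
      (≤-reflexive (sym (∣⁅x⁆∣≡1 t))) (∣singleton⊙∣ t S)
      where
      arith : ∀ p k s e q → p + e ≤ q + k → 1 ≤ e → q ≤ s → 1 + p ≤ k + s
      arith p k s e q h₁ h₂ h₃ = lin 0 (h₁ ⊕ h₂ ⊕ h₃) (solve (p ∷ k ∷ s ∷ e ∷ q ∷ []))

    2-atom-small : ∀ {p k} → p + ∣ T ∣ ≤ ∣ T ⊙ S ∣ + k → suc p ≤ k + ∣ S ∣
    2-atom-small {p} {k} h = arith p k (∣ S ∣) (∣ T ∣) (∣ T ⊙ S ∣) h T-small
      where
      arith : ∀ p k s e q → p + e ≤ q + k → 1 + q ≤ e + s → 1 + p ≤ k + s
      arith p k s e q h₁ h₂ = lin 0 (h₁ ⊕ h₂) (solve (p ∷ k ∷ s ∷ e ∷ q ∷ []))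

    to-inv : ∀ {p k} → suc p ≤ k + ∣ S ∣ → suc p ≤ k + ∣ inv S ∣
    to-inv {p} {k} = subst (λ s → suc p ≤ k + s) (sym (∣inv∣ S))

    proper : ∀ {K R} → Nonempty R → IsAtom 1 R K → Nonempty (∁ K)
    proper {K} {R} ne atomK = 1≤∣∣⇒Nonempty (∁ K) (arith (∣ K ∣) (∣ ∁ K ∣) (∣ K ⊙ R ∣) (∣ K ⋆ R ∣)
      (∣X∣≤∣X⊙S∣ ne) (proj₂ (IsAtom.adm atomK)) (≤-reflexive (trans (∣⊙∣+∣⋆∣ K R) (sym (∣p∣+∣∁p∣ K)))))
      where
      arith : ∀ k k′ p q → k ≤ p → 1 ≤ q → p + q ≤ k + k′ → 1 ≤ k′
      arith k k′ p q h₁ h₂ h₃ = lin 0 (h₁ ⊕ h₂ ⊕ h₃) (solve (k ∷ k′ ∷ p ∷ q ∷ []))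

    -- If a singleton is a 1-atom, then no set has smaller excess.
    singleton-atom⇒cd : ∀ {R K x} → IsAtom 1 R K → ∣ K ∣ ≤ 1 → ∀ {p} →
      ∣ K ⊙ R ∣ + x ≤ p + ∣ K ∣ → x + ∣ R ∣ ≤ suc p
    singleton-atom⇒cd {R} {K} {x} atomK K≤1 {p} h = arith x (∣ R ∣) (∣ K ⊙ R ∣) (∣ K ∣) p h K≤1
      (∣S∣≤∣X⊙S∣ (1≤∣∣⇒Nonempty K (proj₁ (IsAtom.adm atomK))))
      where
      arith : ∀ x r q k p → q + x ≤ p + k → k ≤ 1 → r ≤ q → x + r ≤ 1 + p
      arith x r q k p h₁ h₂ h₃ = lin 0 (h₁ ⊕ h₂ ⊕ h₃) (solve (x ∷ r ∷ q ∷ k ∷ p ∷ []))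

    by-2-atom : CauchyDavenport S → CauchyDavenport (inv S) → ∀ {A} → IsAtom 2 S A ⊎ IsAtom 2 (inv S) A → Structure
    by-2-atom cd cd⁻ (inj₁ atom) = case small-atom⇒structure cd atom (2-atom-small (IsAtom.least atom admT))
        S-nonempty s≤n 16n≤ of λ where
      (inj₁ progression) → inj₁ (inj₁ progression)
      (inj₂ subgroup)    → inj₂ (inj₁ subgroup)
    by-2-atom cd cd⁻ (inj₂ atom) = case small-atom⇒structure cd⁻ atom (to-inv (2-atom-small (from-least⁻ atom admT)))
        inv-nonempty (subst (_≤ n) (sym (∣inv∣ S)) s≤n) (subst (λ s → 16 * n ≤ (n ∸ s) ^ 2) (sym (∣inv∣ S)) 16n≤)
        of λ where
      (inj₁ progression) → inj₁ (inj₂ progression)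
      (inj₂ subgroup)    → inj₂ (inj₂ subgroup)

    by-1-atom : ∀ {F} → IsAtom 1 S F ⊎ IsAtom 1 (inv S) F → Structure
    by-1-atom (inj₁ atom) = conclude (1-atom⇒Subgroup atom)
      where
      conclude : (∃ λ K → IsAtom 1 S K × Subgroup K) → Structure
      conclude (K , atomK , K-subgroup) with 2 ≤? ∣ K ∣
      ... | yes 2≤K = inj₂ (inj₁ (K , K-subgroup , 2≤K , proper S-nonempty atomK ,
              1-atom-small (IsAtom.least atomK adm-t)))
      ... | no  2≰K = by-2-atom
              (λ {X} ne X⋆ → singleton-atom⇒cd atomK (≤-pred (≰⇒> 2≰K)) (IsAtom.least atomK (∈⇒1≤∣∣ (proj₂ ne) , X⋆)))
              (λ {X} ne X⋆ → subst (λ s → ∣ X ∣ + s ≤ suc ∣ X ⊙ inv S ∣) (sym (∣inv∣ S))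
                (singleton-atom⇒cd atomK (≤-pred (≰⇒> 2≰K)) (IsAtom.least⁻ atomK (∈⇒1≤∣∣ (proj₂ ne) , X⋆))))
              (proj₂ (atom-exists admT))
    by-1-atom (inj₂ atom) = conclude (1-atom⇒Subgroup atom)
      where
      conclude : (∃ λ K → IsAtom 1 (inv S) K × Subgroup K) → Structure
      conclude (K , atomK , K-subgroup) with 2 ≤? ∣ K ∣
      ... | yes 2≤K = inj₂ (inj₂ (K , K-subgroup , 2≤K , proper inv-nonempty atomK ,
              to-inv (1-atom-small (from-least⁻ atomK adm-t))))
      ... | no  2≰K = by-2-atom
              (λ {X} ne X⋆ → subst (λ s → ∣ X ∣ + s ≤ suc ∣ X ⊙ S ∣) (∣inv∣ S)
                (singleton-atom⇒cd atomK (≤-pred (≰⇒> 2≰K)) (from-least⁻ atomK (∈⇒1≤∣∣ (proj₂ ne) , X⋆))))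
              (λ {X} ne X⋆ → singleton-atom⇒cd atomK (≤-pred (≰⇒> 2≰K)) (IsAtom.least atomK (∈⇒1≤∣∣ (proj₂ ne) , X⋆)))
              (proj₂ (atom-exists admT))

  pow-∙-comm : ∀ a i → pow a i ∙ a ≡ a ∙ pow a i
  pow-∙-comm a zero    = trans (identityˡ a) (sym (identityʳ a))
  pow-∙-comm a (suc i) = trans (assoc a (pow a i) a) (cong (a ∙_) (pow-∙-comm a i))

  pow-⁻¹ : ∀ a i → pow (a ⁻¹) i ≡ pow a i ⁻¹
  pow-⁻¹ a zero    = sym ε⁻¹≈ε
  pow-⁻¹ a (suc i) = trans (cong (a ⁻¹ ∙_) (pow-⁻¹ a i))
    (trans (sym (⁻¹-anti-homo-∙ (pow a i) a)) (cong _⁻¹ (pow-∙-comm a i)))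

  -- X consists of the powers a⁰, …, aᵏ⁻¹.
  PowersOf : Fin n → ℕ → Subset n → Set
  PowersOf a k X = (∀ {z} → z ∈ X → ∃ λ i → i < k × z ≡ pow a i) × (∀ i → i < k → pow a i ∈ X)

  Progression⇒powers : ∀ {S} → Progression S → ∃₂ λ a g → PowersOf a ∣ S ∣ (S ⊙ ⁅ g ⁆)
  Progression⇒powers {S} (a , y , index , run) = a , y ⁻¹ , power , λ i i<s →
    subst (_∈ S ⊙ ⁅ y ⁻¹ ⁆) (xy∙y⁻¹≡x (pow a i) y) (∈⊙⁺ (run i i<s) (x∈⁅x⁆ (y ⁻¹)))
    where
    power : ∀ {z} → z ∈ S ⊙ ⁅ y ⁻¹ ⁆ → ∃ λ i → i < ∣ S ∣ × z ≡ pow a i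
    power z∈ with ∈⊙⁻ z∈
    ... | x , g , x∈ , g∈ , refl with index x∈
    ...   | i , i<s , refl = i , i<s ,
            trans (cong ((pow a i ∙ y) ∙_) (x∈⁅y⁆⇒x≡y (y ⁻¹) g∈)) (xy∙y⁻¹≡x (pow a i) y)

  Progression-inv⇒powers : ∀ {S} → Progression (inv S) → ∃₂ λ a g → PowersOf a ∣ S ∣ (⁅ g ⁆ ⊙ S)
  Progression-inv⇒powers {S} (a , y , index , run) = a ⁻¹ , y , power , λ i i<s →
    subst (_∈ ⁅ y ⁆ ⊙ S) (y∙[aⁱy]⁻¹ i) (∈⊙⁺ (x∈⁅x⁆ y) (∈inv⁻ (run i (subst (i <_) (sym (∣inv∣ S)) i<s))))
    where
    y∙[aⁱy]⁻¹ : ∀ i → y ∙ (pow a i ∙ y) ⁻¹ ≡ pow (a ⁻¹) i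
    y∙[aⁱy]⁻¹ i = trans (cong (y ∙_) (⁻¹-anti-homo-∙ (pow a i) y))
      (trans (x∙x⁻¹y≡y y (pow a i ⁻¹)) (sym (pow-⁻¹ a i)))

    power : ∀ {z} → z ∈ ⁅ y ⁆ ⊙ S → ∃ λ i → i < ∣ S ∣ × z ≡ pow (a ⁻¹) i
    power z∈ with ∈⊙⁻ z∈
    ... | g , x , g∈ , x∈ , refl with index (∈inv⁺ x∈)
    ...   | i , i<s , eq = i , subst (i <_) (∣inv∣ S) i<s ,
            trans (cong₂ _∙_ (x∈⁅y⁆⇒x≡y y g∈) (trans (sym (⁻¹-involutive x)) (cong _⁻¹ eq))) (y∙[aⁱy]⁻¹ i)

-- Transport along the enumeration

-- Fin order with the group structure transported from G, and the comparison
-- of its product sets, progressions and subgroups with those of G.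
module Transport {c ℓ} (G : FiniteGroup c ℓ) where
  open FiniteGroup G using (group; order; enumeration; to; from; Carrier; _≈_; _∙_; _⁻¹; isGroup; rawGroup; rawMonoid;
    ∙-cong; ⁻¹-cong) renaming (ε to εᴳ; refl to ≈-refl; sym to ≈-sym; trans to ≈-trans)
  open Inverse enumeration using (to-cong; from-cong; strictlyInverseˡ; strictlyInverseʳ)
  open GroupProperties group using (⁻¹-involutive)
  open RawMonoidDefinitions rawMonoid using () renaming (_×_ to _×ᴹ_)
  open Subsets G

  infixl 7 _∙ᶠ_

  _∙ᶠ_ : Op₂ (Fin order)
  i ∙ᶠ j = to (from i ∙ from j)

  εᶠ : Fin order
  εᶠ = to εᴳ

  _⁻¹ᶠ : Op₁ (Fin order)
  i ⁻¹ᶠ = to (from i ⁻¹)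

  from-to : ∀ x → from (to x) ≈ x
  from-to = strictlyInverseʳ

  to-from : ∀ i → to (from i) ≡ i
  to-from = strictlyInverseˡ

  to-∙ : ∀ x y → to (x ∙ y) ≡ to x ∙ᶠ to y
  to-∙ x y = to-cong (∙-cong (≈-sym (from-to x)) (≈-sym (from-to y)))

  to-⁻¹ : ∀ x → to (x ⁻¹) ≡ to x ⁻¹ᶠ
  to-⁻¹ x = to-cong (⁻¹-cong (≈-sym (from-to x)))

  isGroupᶠ : IsGroup _≡_ _∙ᶠ_ εᶠ _⁻¹ᶠ
  isGroupᶠ = GroupMonomorphism.isGroup from-isGroupMonomorphism isGroup
    where
    rawGroupᶠ : RawGroup _ _
    rawGroupᶠ = record { Carrier = Fin order ; _≈_ = _≡_ ; _∙_ = _∙ᶠ_ ; ε = εᶠ ; _⁻¹ = _⁻¹ᶠ }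

    from-isGroupMonomorphism : IsGroupMonomorphism rawGroupᶠ rawGroup from
    from-isGroupMonomorphism = record
      { isGroupHomomorphism = record
        { isMonoidHomomorphism = record
          { isMagmaHomomorphism = record
            { isRelHomomorphism = record { cong = λ { refl → ≈-refl } }
            ; homo = λ i j → from-to (from i ∙ from j)
            }
          ; ε-homo = from-to εᴳ
          }
        ; ⁻¹-homo = λ i → from-to (from i ⁻¹)
        }
      ; injective = λ {i} {j} eq → trans (sym (to-from i)) (trans (to-cong eq) (to-from j))
      }

  open FiniteGroupTheory isGroupᶠ using (_⊙_; ∈⊙⁺; ∈⊙⁻; inv; ∈inv⁺; ∈inv⁻; Subgroup; SmallSubgroup; Small; pow;
    PowersOf; Progression⇒powers; Progression-inv⇒powers; Progression; small-set⇒Progression; ∣inv∣; Adm;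
    small-product⇒structure)

  ∈comprehension⁺ : ∀ {p} {P : Carrier → Set p} (P? : Decidable P) {z} → P (from z) → z ∈ comprehension P?
  ∈comprehension⁺ P? = ∈tabulate⁺ (P? ∘ from)

  ∈comprehension⁻ : ∀ {p} {P : Carrier → Set p} (P? : Decidable P) {z} → z ∈ comprehension P? → P (from z)
  ∈comprehension⁻ P? = ∈tabulate⁻ (P? ∘ from)

  -- The predicates that define X · Y, inverses X and powers x k.
  product? : ∀ X Y → Decidable λ z → ∃₂ λ i j → i ∈ X × j ∈ Y × z ≈ from i ∙ from j
  product? X Y z = any? λ i → any? λ j → (i ∈? X) ×-dec (j ∈? Y) ×-dec (z ≈? (from i ∙ from j))

  inverse? : ∀ X → Decidable λ z → ∃ λ i → i ∈ X × z ≈ from i ⁻¹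
  inverse? X z = any? λ i → (i ∈? X) ×-dec (z ≈? (from i ⁻¹))

  power? : ∀ x k → Decidable λ z → ∃ λ (i : Fin k) → z ≈ toℕ i ×ᴹ x
  power? x k z = any? λ i → z ≈? (toℕ i ×ᴹ x)

  ·≡⊙ : ∀ X Y → X · Y ≡ X ⊙ Y
  ·≡⊙ X Y = ⊆-antisym ⊆-direction ⊇-direction
    where
    ⊆-direction : X · Y ⊆ X ⊙ Y
    ⊆-direction {z} z∈ with ∈comprehension⁻ (product? X Y) z∈
    ... | i , j , i∈ , j∈ , eq = subst (_∈ X ⊙ Y) (trans (sym (to-cong eq)) (to-from z)) (∈⊙⁺ i∈ j∈)

    ⊇-direction : X ⊙ Y ⊆ X · Y
    ⊇-direction z∈ with ∈⊙⁻ z∈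
    ... | i , j , i∈ , j∈ , refl = ∈comprehension⁺ (product? X Y) (i , j , i∈ , j∈ , from-to (from i ∙ from j))

  inverses≡inv : ∀ X → inverses X ≡ inv X
  inverses≡inv X = ⊆-antisym ⊆-direction ⊇-direction
    where
    ⊆-direction : inverses X ⊆ inv X
    ⊆-direction {z} z∈ with ∈comprehension⁻ (inverse? X) z∈
    ... | i , i∈ , eq = subst (_∈ inv X) (trans (sym (to-cong eq)) (to-from z)) (∈inv⁺ i∈)

    ⊇-direction : inv X ⊆ inverses X
    ⊇-direction {z} z∈ = ∈comprehension⁺ (inverse? X) (z ⁻¹ᶠ , ∈inv⁻ z∈ ,
      ≈-trans (≈-sym (⁻¹-involutive (from z))) (⁻¹-cong (≈-sym (from-to (from z ⁻¹)))))

  to-power : ∀ i a → to (i ×ᴹ from a) ≡ pow a i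
  to-power zero    a = refl
  to-power (suc i) a = trans (to-∙ (from a) (i ×ᴹ from a)) (cong₂ _∙ᶠ_ (to-from a) (to-power i a))

  PowersOf⇒≡powers : ∀ {a k X} → PowersOf a k X → X ≡ powers (from a) k
  PowersOf⇒≡powers {a} {k} {X} (power , all) = ⊆-antisym ⊆-direction ⊇-direction
    where
    ⊆-direction : X ⊆ powers (from a) k
    ⊆-direction {z} z∈ with power z∈
    ... | i , i<k , z≡ = ∈comprehension⁺ (power? (from a) k) (fromℕ< i<k , ≈-trans (from-cong (trans z≡
      (sym (trans (cong (λ j → to (j ×ᴹ from a)) (toℕ-fromℕ< i<k)) (to-power i a))))) (from-to _))

    ⊇-direction : powers (from a) k ⊆ X
    ⊇-direction {z} z∈ with ∈comprehension⁻ (power? (from a) k) z∈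
    ... | i , eq = subst (_∈ X) (trans (sym (trans (to-cong eq) (to-power (toℕ i) a))) (to-from z)) (all (toℕ i) (toℕ<n i))

  singleton-from : ∀ g → singleton (from g) ≡ ⁅ g ⁆
  singleton-from g = cong ⁅_⁆ (to-from g)

  Progression⇒IsGeometricProgression : ∀ {S} → Progression S ⊎ Progression (inv S) → IsGeometricProgression S
  Progression⇒IsGeometricProgression {S} (inj₁ progression) with Progression⇒powers progression
  ... | a , g , powersOf = from g , from a , inj₂
    (trans (cong (S ·_) (singleton-from g)) (trans (·≡⊙ S ⁅ g ⁆) (PowersOf⇒≡powers powersOf)))
  Progression⇒IsGeometricProgression {S} (inj₂ progression) with Progression-inv⇒powers progression
  ... | a , g , powersOf = from g , from a , inj₁
    (trans (cong (_· S) (singleton-from g)) (trans (·≡⊙ ⁅ g ⁆ S) (PowersOf⇒≡powers powersOf)))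

  Subgroup⇒IsSubgroup : ∀ {K} → Subgroup K → IsSubgroup K
  Subgroup⇒IsSubgroup {K} K-subgroup = record
    { ε-∈       = ε∈
    ; ∙-closed  = λ {x} {y} x∈ y∈ → subst (_∈ K) (sym (to-∙ x y)) (∙∈ x∈ y∈)
    ; ⁻¹-closed = λ {x} x∈ → subst (_∈ K) (sym (to-⁻¹ x)) (⁻¹∈ x∈)
    }
    where open Subgroup K-subgroup

  SmallSubgroup⇒subgroup : ∀ {S R} → R ≡ inv S ⊎ R ≡ S → SmallSubgroup R →
    ∃ λ H → IsSubgroup H × Nontrivial H × Proper H × ∣ H · R ∣ ≤ ∣ H ∣ + ∣ S ∣ ∸ 1
  SmallSubgroup⇒subgroup {S} {R} R≡ (K , K-subgroup , 2≤K , (z , z∈) , K-small) =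
    K , Subgroup⇒IsSubgroup K-subgroup ,
    (λ K≡ → <⇒≱ 2≤K (≤-reflexive (trans (cong ∣_∣ K≡) (∣⁅x⁆∣≡1 εᶠ)))) ,
    (λ K≡⊤ → x∈∁p⇒x∉p z∈ (subst (z ∈_) (sym K≡⊤) ∈⊤)) ,
    ∸-monoˡ-≤ 1 (subst₂ (λ X s → suc ∣ X ∣ ≤ ∣ K ∣ + s) (sym (·≡⊙ K R)) (∣R∣≡∣S∣ R≡) K-small)
    where
    ∣R∣≡∣S∣ : R ≡ inv S ⊎ R ≡ S → ∣ R ∣ ≡ ∣ S ∣
    ∣R∣≡∣S∣ (inj₁ refl) = ∣inv∣ S
    ∣R∣≡∣S∣ (inj₂ refl) = refl

  structure : ∀ S T → 2 ≤ ∣ T ∣ → ∣ T · S ∣ ≤ (order ∸ 2) ⊓ (∣ T ∣ + ∣ S ∣ ∸ 1) → ∣ S ∣ ≤[ order -4√n] →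
    IsGeometricProgression S ⊎
    (∃₂ λ H δ → IsSubgroup H × Nontrivial H × Proper H × ∣ H · S ^ˢ δ ∣ ≤ ∣ H ∣ + ∣ S ∣ ∸ 1)
  structure S T 2≤T TS≤ (s≤n , 16n≤) with nonempty? S
  ... | no empty = inj₁ (Progression⇒IsGeometricProgression (inj₁ (small-set⇒Progression
          (≮⇒≥ λ 1<S → empty (1≤∣∣⇒Nonempty S (≤-trans (s≤s z≤n) 1<S))))))
  ... | yes S-nonempty = conclude (small-product⇒structure S-nonempty (2≤T , 2≤T⋆) T-small s≤n 16n≤)
    where
    TS≤′ : ∣ T ⊙ S ∣ ≤ (order ∸ 2) ⊓ (∣ T ∣ + ∣ S ∣ ∸ 1)
    TS≤′ = subst (λ X → ∣ X ∣ ≤ (order ∸ 2) ⊓ (∣ T ∣ + ∣ S ∣ ∸ 1)) (·≡⊙ T S) TS≤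

    2≤T⋆ : 2 ≤ ∣ ∁ (T ⊙ S) ∣
    2≤T⋆ = subst₂ _≤_ (m∸[m∸n]≡n (≤-trans 2≤T (∣p∣≤n T))) (sym (∣∁p∣≡n∸∣p∣ (T ⊙ S)))
      (∸-monoʳ-≤ order (≤-trans TS≤′ (m⊓n≤m _ _)))

    T-small : Small S T
    T-small = subst (suc ∣ T ⊙ S ∣ ≤_) (m+[n∸m]≡n (≤-trans (≤-trans (s≤s z≤n) 2≤T) (m≤m+n ∣ T ∣ ∣ S ∣)))
      (s≤s (≤-trans TS≤′ (m⊓n≤n (order ∸ 2) _)))

    conclude : (Progression S ⊎ Progression (inv S)) ⊎ (SmallSubgroup S ⊎ SmallSubgroup (inv S)) →
      IsGeometricProgression S ⊎
      (∃₂ λ H δ → IsSubgroup H × Nontrivial H × Proper H × ∣ H · S ^ˢ δ ∣ ≤ ∣ H ∣ + ∣ S ∣ ∸ 1)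
    conclude (inj₁ progression) = inj₁ (Progression⇒IsGeometricProgression progression)
    conclude (inj₂ (inj₁ small)) with SmallSubgroup⇒subgroup (inj₂ refl) small
    ... | H , properties = inj₂ (H , Sign.+ , properties)
    conclude (inj₂ (inj₂ small)) with SmallSubgroup⇒subgroup (inj₁ (inverses≡inv S))
      (subst SmallSubgroup (sym (inverses≡inv S)) small)
    ... | H , properties = inj₂ (H , Sign.- , properties)

corollary2 : ∀ {c ℓ} (G : FiniteGroup c ℓ) →
    let open FiniteGroup G using (order)
        open Subsets G
    in
    (S : Subset order) →
    (∃ λ (T : Subset order) →
      2 ≤ ∣ T ∣ × ∣ T · S ∣ ≤ (order ∸ 2) ⊓ (∣ T ∣ + ∣ S ∣ ∸ 1)) →
    ∣ S ∣ ≤[ order -4√n] →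
    IsGeometricProgression S ⊎
    (∃₂ λ H ε →
      IsSubgroup H × Nontrivial H × Proper H ×
      ∣ H · S ^ˢ ε ∣ ≤ ∣ H ∣ + ∣ S ∣ ∸ 1)
corollary2 G S (T , 2≤T , TS≤) = Transport.structure G S T 2≤T TS≤
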